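{- For every $n\ge 1$, if the edges of the complete graph $K_n$ are $2$-locally coloured, then the vertex set of $K_n$ can be partitioned into two vertex-disjoint monochromatic cycles of different colours.
   Context: An edge colouring of a graph is a $2$-local colouring if the edges incident to any vertex are coloured with at most $2$ colours; the total number of colours used is not restricted. A cycle is monochromatic if all its edges have the same colour. By convention, a single vertex, a single edge, and the empty set are also considered to be cycles (of any colour). -}

module Defs where

open import Data.Nat using (ℕ; _≤_)
open import Data.Fin using (Fin)
open import Data.List using (List; []; _∷_; _∷ʳ_; length)
open import Data.List.Membership.Propositional using (_∈_)
open import Data.List.Relation.Binary.Disjoint.Propositional using (Disjoint)
open import Data.List.Relation.Unary.Linked using (Linked)
open import Data.List.Relation.Unary.Unique.Propositional using (Unique)
open import Data.Product using (_×_; ∃-syntax)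
open import Data.Sum using (_⊎_)
open import Relation.Binary.PropositionalEquality using (_≡_; _≢_)

-- An unlimited supply of colours; a colouring may use any number of them.
Colour : Set
Colour = ℕ

-- An edge colouring of the complete graph with vertex set Fin n. The diagonal
-- values of `colour` are junk: no definition below consults them.
record EdgeColouring (n : ℕ) : Set where
  field
    colour     : Fin n → Fin n → Colour
    colour-sym : ∀ u v → colour u v ≡ colour v u

open EdgeColouring public

IsLocal : ∀ {n} → ℕ → EdgeColouring n → Set
IsLocal k χ =
  ∀ v → ∃[ S ] length S ≤ k × (∀ u → u ≢ v → colour χ v u ∈ S)

-- `MonoCycle χ a vs`: the vertices vs, in this cyclic order, form a
-- monochromatic cycle of colour a. The empty set, a single vertex and a single
-- edge are by convention cycles of every colour, so for these the colour a
-- is unconstrained.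
data MonoCycle {n : ℕ} (χ : EdgeColouring n) (a : Colour) : List (Fin n) → Set where
  empty  : MonoCycle χ a []
  vertex : ∀ v → MonoCycle χ a (v ∷ [])
  edge   : ∀ {u v} → u ≢ v → MonoCycle χ a (u ∷ v ∷ [])
  cycle  : ∀ {u v w vs} →
           Unique (u ∷ v ∷ w ∷ vs) →
           -- Repeating u at the end accounts for the closing edge.
           Linked (λ x y → colour χ x y ≡ a) ((u ∷ v ∷ w ∷ vs) ∷ʳ u) →
           MonoCycle χ a (u ∷ v ∷ w ∷ vs)

IsPartition : ∀ {n} → List (Fin n) → List (Fin n) → Set
IsPartition xs ys = Disjoint xs ys × (∀ v → v ∈ xs ⊎ v ∈ ys)

{-# OPTIONS --safe #-}
-- A 2-local colouring either has a colour a such that every vertex sees at most one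
-- other colour (a star), or uses exactly three colours, every vertex seeing two of them
-- (a triangle).  For a star the colours other than a may be identified, since a cycle
-- avoiding a then stays within one of them; this leaves the theorem of Bessy and Thomassé
-- on a red/blue colouring.  For a triangle the three classes are joined completely, and
-- the vertices of one class can be distributed over two cycles through the other two.
--
-- For red and blue (R and B), suppose that there is no partition.  By Gyárfás's argument
-- the vertices are covered by a red path x … y and a disjoint blue cycle S, or the same
-- with the colours exchanged; take the path shortest possible.  Then x y is blue, a blue
-- Hamiltonian path of S has an end joined in red to both x and y, and if r is a vertex of
-- S joined in red to both, then the ends of a blue Hamiltonian path of S - r are joined in
-- red.  Thus two steps along S over such an r form a red edge, and S falls apart into red
-- strands, each starting just after and ending just before a vertex not joined to both
-- ends.  The starts form a red clique and so do the ends, so the strands fit together to a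
-- red Hamiltonian path of S, which closes up with the path, unless S alternates
-- y₀ z₀ y₁ z₁ … with all zᵢ joined in red to x and y.  In that case one finds successively
-- that all edges between the yᵢ and the zᵢ are blue, and the resulting freedom to reroute
-- both cycles gives a partition or a shorter path.
module Submission where

open import Defs
import Algebra.Solver.CommutativeMonoid
open import Data.Empty using (⊥; ⊥-elim)
open import Data.Fin using (Fin)
open import Data.Fin.Properties using (any?) renaming (_≟_ to _≟ᶠ_)
open import Data.List using (List; []; _∷_; _++_; _∷ʳ_; length; allFin)
open import Data.List.Membership.Propositional using (_∈_)
import Data.List.Membership.DecPropositional as DecMembership
open import Data.List.Membership.Propositional.Properties using (∈-++⁺ˡ; ∈-++⁺ʳ; ∈-++⁻; ∈-allFin)
open import Data.List.Properties using (++-assoc; length-++; length-tabulate)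
open import Data.List.Relation.Binary.Permutation.Propositional
  using (_↭_; ↭-refl; ↭-sym; ↭-trans; ↭-reflexive; prep; swap)
open import Data.List.Relation.Binary.Permutation.Propositional.Properties
  using (++⁺; ++⁺ˡ; ++⁺ʳ; ++-comm; ∈-resp-↭; All-resp-↭; ↭-length; shift; ++-commutativeMonoid)
open import Data.List.Relation.Unary.All as All using (All; []; _∷_)
open import Data.List.Relation.Unary.All.Properties using (++⁻ˡ)
open import Data.List.Relation.Unary.AllPairs using ([]; _∷_)
open import Data.List.Relation.Unary.Any using (here; there)
open import Data.List.Relation.Unary.Any.Properties using (¬Any[])
open import Data.List.Relation.Unary.Linked as Linked using (Linked; [-]; _∷_)
import Data.List.Relation.Unary.Unique.DecPropositional as DecUnique
open import Data.List.Relation.Unary.Unique.Propositional using (Unique)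
open import Data.List.Relation.Unary.Unique.Propositional.Properties using (allFin⁺)
open import Data.Nat
  using (ℕ; zero; suc; _+_; _*_; _∸_; _≤_; _<_; _≥_; z≤n; s≤s; s≤s⁻¹; NonZero; _≟_; _≤?_)
open import Data.Nat.DivMod using (_/_; _%_; m≡m%n+[m/n]*n; m%n<n)
open import Data.Nat.Properties
  using (≤-refl; ≤-reflexive; ≤-trans; ≤-antisym; <-irrefl; <-cmp; <⇒≤; <⇒≱; ≰⇒>; n≤1+n; 1+n≢n;
         m≤n⇒m≤1+n; m≤n⇒∃[o]m+o≡n; m≤m+n; m≤n+m; suc-injective; +-suc; +-assoc; +-comm; +-identityʳ;
         +-mono-<; +-mono-≤; +-cancelˡ-≤; ∸-monoˡ-≤; m+[n∸m]≡n; m∸n+n≡m; m+n∸m≡n; m+n∸n≡m; m≤n+o⇒m∸n≤o)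
open import Data.Nat.Tactic.RingSolver using (solve-∀)
open import Data.Product using (_×_; _,_; ∃-syntax; proj₁; proj₂)
open import Data.Sum as Sum using (_⊎_; inj₁; inj₂)
open import Data.Unit using (⊤; tt)
open import Function using (_∘_)
open import Relation.Binary using (tri<; tri≈; tri>)
open import Relation.Binary.PropositionalEquality
  using (_≡_; _≢_; refl; sym; trans; cong; cong₂; subst)
open import Relation.Nullary using (¬_; Dec; yes; no)
open import Relation.Nullary.Decidable using (_×-dec_; ¬?; map′)

-- Paths and cycles up to reordering

module Bag {V : Set} where
  open Algebra.Solver.CommutativeMonoid (++-commutativeMonoid {A = V}) public
    using (solve; _⊕_; _⊜_) renaming (id to ∅)

open Bag

module _ {V : Set} where

  -- The vertex list of a path only matters up to reordering; building the
  -- reordering into the definition makes paths concatenable segments.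
  data Path (E : V → V → Set) : V → V → List V → Set where
    [_]     : ∀ v → Path E v v (v ∷ [])
    join    : ∀ {u v w z S T} → Path E u v S → E v w → Path E w z T → Path E u z (S ++ T)
    reorder : ∀ {u v S T} → S ↭ T → Path E u v S → Path E u v T

  data MaybePath (E : V → V → Set) : List V → Set where
    none : MaybePath E []
    some : ∀ {u v S} → Path E u v S → MaybePath E S

  data Cycle (E : V → V → Set) : List V → Set where
    none    : Cycle E []
    single  : ∀ v → Cycle E (v ∷ [])
    pair    : ∀ u v → Cycle E (u ∷ v ∷ [])
    closed  : ∀ {u v S} → Path E u v S → E v u → Cycle E S
    reorder : ∀ {S T} → S ↭ T → Cycle E S → Cycle E T

  data Uncons (E : V → V → Set) (u v : V) (S : List V) : Set where
    only : u ≡ v → S ↭ u ∷ [] → Uncons E u v S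
    more : ∀ {w T} → E u w → Path E w v T → S ↭ u ∷ T → Uncons E u v S

  module _ {E : V → V → Set} where

    start∈ : ∀ {u v S} → Path E u v S → u ∈ S
    start∈ [ v ]         = here refl
    start∈ (join p _ _)  = ∈-++⁺ˡ (start∈ p)
    start∈ (reorder σ p) = ∈-resp-↭ σ (start∈ p)

    end∈ : ∀ {u v S} → Path E u v S → v ∈ S
    end∈ [ v ]                = here refl
    end∈ (join {S = S} _ _ q) = ∈-++⁺ʳ S (end∈ q)
    end∈ (reorder σ p)        = ∈-resp-↭ σ (end∈ p)

    uncons : ∀ {u v S} → Path E u v S → Uncons E u v S
    uncons [ v ] = only refl ↭-refl
    uncons (join {T = T} p e q) with uncons p
    ... | only refl σ   = more e q (++⁺ʳ T σ)
    ... | more e′ p′ σ  = more e′ (join p′ e q) (++⁺ʳ T σ)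
    uncons (reorder σ p) with uncons p
    ... | only eq τ   = only eq (↭-trans (↭-sym σ) τ)
    ... | more e q τ  = more e q (↭-trans (↭-sym σ) τ)

    dropStart : ∀ {u v S} → Path E u v S → ∃[ T ] MaybePath E T × S ↭ u ∷ T
    dropStart p with uncons p
    ... | only _ σ   = _ , none , σ
    ... | more _ q σ = _ , some q , σ

    vertices : ∀ {u v S} → Path E u v S →
      ∃[ ts ] u ∷ ts ↭ S × (∀ {w ws} → E v w → Linked E (w ∷ ws) → Linked E ((u ∷ ts) ++ w ∷ ws))
    vertices [ v ] = [] , ↭-refl , _∷_
    vertices (join {u = u} {w = w} p e q) with vertices p | vertices q
    ... | ts , σ , link | ts′ , σ′ , link′ =
      ts ++ w ∷ ts′ , ++⁺ σ σ′ ,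
      λ {x} {xs} e′ l → subst (λ zs → Linked E (u ∷ zs)) (sym (++-assoc ts (w ∷ ts′) (x ∷ xs)))
        (link e (link′ e′ l))
    vertices (reorder σ p) with vertices p
    ... | ts , τ , link = ts , ↭-trans τ σ , link

    module _ (E-sym : ∀ {u v} → E u v → E v u) where

      reverse : ∀ {u v S} → Path E u v S → Path E v u S
      reverse [ v ]                        = [ v ]
      reverse (join {S = S} {T = T} p e q) = reorder (++-comm T S) (join (reverse q) (E-sym e) (reverse p))
      reverse (reorder σ p)                = reorder σ (reverse p)

      dropEnd : ∀ {u v S} → Path E u v S → ∃[ T ] MaybePath E T × S ↭ v ∷ T
      dropEnd p = dropStart (reverse p)

  unique-↭ : ∀ {S T : List V} → S ↭ T → Unique S → Unique T
  unique-↭ _↭_.refl uniq                                   = uniq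
  unique-↭ (prep x σ) (x∉ ∷ uniq)                          = All-resp-↭ σ x∉ ∷ unique-↭ σ uniq
  unique-↭ (swap x y σ) ((x≢y ∷ x∉) ∷ y∉ ∷ uniq)           =
    (x≢y ∘ sym ∷ All-resp-↭ σ y∉) ∷ All-resp-↭ σ x∉ ∷ unique-↭ σ uniq
  unique-↭ (_↭_.trans σ τ) uniq                            = unique-↭ τ (unique-↭ σ uniq)

  unique-++⇒≢ : ∀ S {T : List V} {u v} → Unique (S ++ T) → u ∈ S → v ∈ T → u ≢ v
  unique-++⇒≢ (_ ∷ S) (u∉ ∷ _) (here refl) v∈T refl = All.lookup u∉ (∈-++⁺ʳ S v∈T) refl
  unique-++⇒≢ (_ ∷ S) (_ ∷ uniq) (there u∈S) v∈T    = unique-++⇒≢ S uniq u∈S v∈T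

  unique-++ˡ : ∀ S {T : List V} → Unique (S ++ T) → Unique S
  unique-++ˡ []      _             = []
  unique-++ˡ (_ ∷ S) (u∉ ∷ uniq) = ++⁻ˡ S u∉ ∷ unique-++ˡ S uniq

  module _ {A B : V → V → Set}
           (A-sym : ∀ {u v} → A u v → A v u) (B-sym : ∀ {u v} → B u v → B v u) where

    two-paths : ∀ {X} → Unique X → (∀ {u v} → u ∈ X → v ∈ X → u ≢ v → A u v ⊎ B u v) →
      ∃[ S ] ∃[ T ] MaybePath A S × MaybePath B T × S ++ T ↭ X
    two-paths {[]} _ _ = [] , [] , none , none , ↭-refl
    two-paths {v ∷ X} (v∉X ∷ uniq) total
      with two-paths uniq (λ p q → total (there p) (there q))
    ... | .[] , T , none , q , σ = v ∷ [] , T , some [ v ] , q , prep v σ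
    ... | S , .[] , some p , none , σ =
      S , v ∷ [] , some p , some [ v ] ,
      ↭-trans (++-comm S _) (prep v (↭-trans (solve 1 (λ s → s ⊜ s ⊕ ∅) ↭-refl S) σ))
    ... | S , T , some {u′} {u} p , some {w′} {w} q , σ
      with ∈-resp-↭ σ (∈-++⁺ˡ (end∈ p)) | ∈-resp-↭ σ (∈-++⁺ʳ S (end∈ q))
    ... | u∈X | w∈X
      with total (there u∈X) (here refl) (λ { refl → All.lookup v∉X u∈X refl })
         | total (there w∈X) (here refl) (λ { refl → All.lookup v∉X w∈X refl })
    ... | inj₁ uv | _ =
      S ++ v ∷ [] , T , some (join p uv [ v ]) , some q ,
      ↭-trans (solve 3 (λ s v t → (s ⊕ v) ⊕ t ⊜ v ⊕ s ⊕ t) ↭-refl S (v ∷ []) T) (prep v σ)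
    ... | inj₂ _ | inj₂ wv =
      S , T ++ v ∷ [] , some p , some (join q wv [ v ]) ,
      ↭-trans (solve 3 (λ s v t → s ⊕ t ⊕ v ⊜ v ⊕ s ⊕ t) ↭-refl S (v ∷ []) T) (prep v σ)
    ... | inj₂ uv | inj₁ wv
      with total (there u∈X) (there w∈X) (unique-++⇒≢ S (unique-↭ (↭-sym σ) uniq) (end∈ p) (end∈ q))
    ... | inj₁ uw with dropEnd B-sym q
    ...   | T′ , q′ , τ =
      S ++ w ∷ v ∷ [] , T′ , some (join p uw (join [ w ] wv [ v ])) , q′ ,
      ↭-trans (solve 4 (λ s w v t → (s ⊕ w ⊕ v) ⊕ t ⊜ v ⊕ s ⊕ w ⊕ t) ↭-refl S (w ∷ []) (v ∷ []) T′)
        (prep v (↭-trans (++⁺ˡ S (↭-sym τ)) σ))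
    two-paths {v ∷ X} (v∉X ∷ uniq) total
        | S , T , some {u′} {u} p , some {w′} {w} q , σ | u∈X | w∈X | inj₂ uv | inj₁ wv | inj₂ uw with dropEnd A-sym p
    ...   | S′ , p′ , τ =
      S′ , T ++ u ∷ v ∷ [] , p′ , some (join q (B-sym uw) (join [ u ] uv [ v ])) ,
      ↭-trans (solve 4 (λ s u v t → s ⊕ t ⊕ u ⊕ v ⊜ v ⊕ (u ⊕ s) ⊕ t) ↭-refl S′ (u ∷ []) (v ∷ []) T)
        (prep v (↭-trans (++⁺ʳ T (↭-sym τ)) σ))

-- Periodic sequences and strands

double : ℕ → ℕ
double zero    = zero
double (suc n) = suc (suc (double n))

double-+ : ∀ m n → double (m + n) ≡ double m + double n
double-+ zero    n = refl
double-+ (suc m) n = cong (suc ∘ suc) (double-+ m n)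

even-or-odd : ∀ n → (∃[ k ] n ≡ double k) ⊎ (∃[ k ] n ≡ suc (double k))
even-or-odd zero = inj₁ (0 , refl)
even-or-odd (suc n) with even-or-odd n
... | inj₁ (k , eq) = inj₂ (k , cong suc eq)
... | inj₂ (k , eq) = inj₁ (suc k , cong suc eq)

double-mono-< : ∀ {m n} → m < n → suc (double m) < double n
double-mono-< {zero}  {suc n} _       = s≤s (s≤s z≤n)
double-mono-< {suc m} {suc n} (s≤s p) = s≤s (s≤s (double-mono-< p))

all-below? : ∀ {P Q : ℕ → Set} → (∀ i → P i ⊎ Q i) → ∀ n → (∀ i → i < n → P i) ⊎ (∃[ i ] i < n × Q i)
all-below? dec zero = inj₁ λ _ ()
all-below? {P} dec (suc n) with dec n | all-below? dec n
... | inj₂ q | _                  = inj₂ (n , ≤-refl , q)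
... | _      | inj₂ (i , i<n , q) = inj₂ (i , m≤n⇒m≤1+n i<n , q)
... | inj₁ p | inj₁ ps            = inj₁ below
  where
  below : ∀ i → i < suc n → P i
  below i (s≤s i≤n) with <-cmp i n
  ... | tri< i<n _ _ = ps i i<n
  ... | tri≈ _ refl _ = p
  ... | tri> _ _ n<i = ⊥-elim (<⇒≱ n<i i≤n)

module _ {V : Set} where

  range : (ℕ → V) → ℕ → ℕ → List V
  range f i zero    = []
  range f i (suc n) = f i ∷ range f (suc i) n

  range-++ : ∀ f a b {i} → range f i (a + b) ≡ range f i a ++ range f (a + i) b
  range-++ f zero    b     = refl
  range-++ f (suc a) b {i} = cong (f i ∷_) (trans (range-++ f a b)
    (cong (λ j → range f (suc i) a ++ range f j b) (+-suc a i)))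

  range-shift : ∀ f s i n → range (λ j → f (s + j)) i n ≡ range f (s + i) n
  range-shift f s i zero    = refl
  range-shift f s i (suc n) =
    cong (f (s + i) ∷_) (trans (range-shift f s (suc i) n) (cong (λ j → range f j n) (+-suc s i)))

  range-length : ∀ f i n → length (range f i n) ≡ n
  range-length f i zero    = refl
  range-length f i (suc n) = cong suc (range-length f (suc i) n)

  range-index : ∀ {f : ℕ → V} {i n u} → u ∈ range f i n → ∃[ j ] j < n + i × u ≡ f j
  range-index {n = suc n} (here refl) = _ , s≤s (m≤n+m _ n) , refl
  range-index {i = i} {n = suc n} (there u∈) with range-index u∈
  ... | j , j< , eq = j , ≤-trans j< (≤-reflexive (+-suc n i)) , eq

  interleave : ∀ f i n →
    range (f ∘ double) i n ++ range (f ∘ suc ∘ double) i n ↭ range f (double i) (double n)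
  interleave f i zero    = ↭-refl
  interleave f i (suc n) =
    ↭-trans (solve 4 (λ a b c d → (a ⊕ c) ⊕ b ⊕ d ⊜ a ⊕ b ⊕ c ⊕ d) ↭-refl
              (f (double i) ∷ []) (f (suc (double i)) ∷ [])
              (range (f ∘ double) (suc i) n) (range (f ∘ suc ∘ double) (suc i) n))
      (prep _ (prep _ (interleave f (suc i) n)))

  interleave-odd : ∀ f i n →
    range (f ∘ double) i (suc n) ++ range (f ∘ suc ∘ double) i n ↭ range f (double i) (suc (double n))
  interleave-odd f i zero    = ↭-refl
  interleave-odd f i (suc n) =
    ↭-trans (solve 4 (λ a b c d → (a ⊕ c) ⊕ b ⊕ d ⊜ a ⊕ b ⊕ c ⊕ d) ↭-refl
              (f (double i) ∷ []) (f (suc (double i)) ∷ [])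
              (range (f ∘ double) (suc i) (suc n)) (range (f ∘ suc ∘ double) (suc i) n))
      (prep _ (prep _ (interleave-odd f (suc i) n)))

  module Periodic (f : ℕ → V) (n : ℕ) (per : ∀ i → f (n + i) ≡ f i) where

    range-rotate : ∀ i → range f (suc i) n ↭ range f i n
    range-rotate i = go n (per i)
      where
      go : ∀ m → f (m + i) ≡ f i → range f (suc i) m ↭ range f i m
      go zero    _  = ↭-refl
      go (suc m) eq =
        ↭-trans (↭-reflexive (trans (cong (range f (suc i)) (+-comm 1 m)) (range-++ f m 1)))
        (↭-trans (++-comm (range f (suc i) m) _)
          (↭-reflexive (cong (_∷ range f (suc i) m) (trans (cong f (+-suc m i)) eq))))

    range-start : ∀ i → range f 0 n ↭ range f i n
    range-start zero    = ↭-refl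
    range-start (suc i) = ↭-trans (range-start i) (↭-sym (range-rotate i))

    multiple : ∀ a i → f (a * n + i) ≡ f i
    multiple zero    i = refl
    multiple (suc a) i = trans (cong f (+-assoc n (a * n) i)) (trans (per _) (multiple a i))

    everywhere : .{{NonZero n}} → ∀ {P : V → Set} → (∀ i → i < n → P (f i)) → ∀ i → P (f i)
    everywhere {P} below i = subst P
      (trans (sym (multiple (i / n) (i % n)))
        (cong f (trans (+-comm (i / n * n) (i % n)) (sym (m≡m%n+[m/n]*n i n)))))
      (below (i % n) (m%n<n i n))

  module _ {E : V → V → Set} where

    castEnd : ∀ {u v v′ S} → v ≡ v′ → Path E u v S → Path E u v′ S
    castEnd refl p = p

    segment≤ : ∀ f i n → (∀ t → t < n → E (f (t + i)) (f (suc t + i))) → Path E (f i) (f (n + i)) (range f i (suc n))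
    segment≤ f i zero    step = [ f i ]
    segment≤ f i (suc n) step = castEnd (cong f (+-suc n i))
      (join [ f i ] (step 0 (s≤s z≤n)) (segment≤ f (suc i) n
        λ t t<n → subst (λ j → E (f j) (f (suc j))) (sym (+-suc t i)) (step (suc t) (s≤s t<n))))

    segment : ∀ f → (∀ i → E (f i) (f (suc i))) → ∀ i n → Path E (f i) (f (n + i)) (range f i (suc n))
    segment f step i n = segment≤ f i n λ t _ → step (t + i)

  Labelled : (W : ℕ → Set) (f : ℕ → V) → ℕ → V → Set
  Labelled W f n v = ∃[ i ] i < suc n × W i × v ≡ f i

  gap : ∀ {n i j} → i < j → j < suc n → ∃[ d ] ∃[ e ] j ≡ suc d + i × n ≡ suc d + e
  gap {n} {i} i<j j≤n with m≤n⇒∃[o]m+o≡n i<j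
  ... | d , refl with m≤n⇒∃[o]m+o≡n j≤n
  ...   | o , eq = d , i + o , cong suc (+-comm i d) , suc-injective (trans (sym eq) (lemma i d o))
    where
    lemma : ∀ i d o → suc (suc i + d + o) ≡ suc (suc d + (i + o))
    lemma = solve-∀

  labelled-clique : ∀ {R : V → V → Set} (R-sym : ∀ {u v} → R u v → R v u) {W : ℕ → Set} {f n} →
    (∀ i d e → n ≡ suc d + e → W i → W (suc d + i) → R (f i) (f (suc d + i))) →
    ∀ {u v} → Labelled W f n u → Labelled W f n v → u ≢ v → R u v
  labelled-clique R-sym lt (i , i≤ , wi , refl) (j , j≤ , wj , refl) u≢v with <-cmp i j
  ... | tri≈ _ refl _ = ⊥-elim (u≢v refl)
  ... | tri< i<j _ _ with gap i<j j≤
  ...   | d , e , refl , eq = lt i d e eq wi wj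
  labelled-clique R-sym lt (i , i≤ , wi , refl) (j , j≤ , wj , refl) u≢v | tri> _ _ j<i with gap j<i i≤
  ...   | d , e , refl , eq = R-sym (lt j d e eq wj wi)

  record Strand (R : V → V → Set) (Plus Minus : V → Set) (s : V) (S : List V) : Set where
    constructor strand
    field
      {end} : V
      plus  : Plus s
      minus : Minus end
      path  : Path R s end S

  data Strands (R : V → V → Set) (Plus Minus : V → Set) : V → List V → Set where
    one : ∀ {s S} → Strand R Plus Minus s S → Strands R Plus Minus s S
    _∷_ : ∀ {s s′ S T} → Strand R Plus Minus s S → Strands R Plus Minus s′ T → Strands R Plus Minus s (S ++ T)

  strands-plus : ∀ {R Plus Minus s T} → Strands R Plus Minus s T → Plus s
  strands-plus (one x) = Strand.plus x
  strands-plus (x ∷ _) = Strand.plus x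

  module _ {R : V → V → Set} (R-sym : ∀ {u v} → R u v → R v u) {Plus Minus : V → Set}
    (plus-clique : ∀ {u v} → Plus u → Plus v → u ≢ v → R u v)
    (minus-clique : ∀ {u v} → Minus u → Minus v → u ≢ v → R u v) where

    attach : ∀ {s e K s′ T} → Path R s e K → Plus e ⊎ Minus e → Strand R Plus Minus s′ T → Unique (K ++ T) →
      ∃[ e′ ] Path R s e′ (K ++ T) × (Plus e′ ⊎ Minus e′)
    attach {K = K} p (inj₁ pl) (strand pl′ mi′ q) uniq =
      _ , join p (plus-clique pl pl′ (unique-++⇒≢ K uniq (end∈ p) (start∈ q))) q , inj₂ mi′
    attach {K = K} p (inj₂ mi) (strand pl′ mi′ q) uniq =
      _ , join p (minus-clique mi mi′ (unique-++⇒≢ K uniq (end∈ p) (end∈ q))) (reverse R-sym q) , inj₁ pl′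

    attach-all : ∀ {s e K s′ T} → Path R s e K → Plus e ⊎ Minus e → Strands R Plus Minus s′ T → Unique (K ++ T) →
      ∃[ e′ ] Path R s e′ (K ++ T) × (Plus e′ ⊎ Minus e′)
    attach-all p end (one x) uniq = attach p end x uniq
    attach-all {K = K} p end (_∷_ {S = S} {T = T} x xs) uniq
      with assoc ← ↭-reflexive (++-assoc K S T)
      with attach p end x (unique-++ˡ (K ++ S) (unique-↭ (↭-sym assoc) uniq))
    ... | _ , p′ , end′ with attach-all p′ end′ xs (unique-↭ (↭-sym assoc) uniq)
    ...   | e″ , p″ , end″ = e″ , reorder assoc p″ , end″

    strands⇒path : ∀ {s T} → Strands R Plus Minus s T → Unique T → ∃[ e ] Path R s e T × (Plus e ⊎ Minus e)
    strands⇒path (one (strand _ mi p)) _          = _ , p , inj₂ mi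
    strands⇒path (strand _ mi p ∷ xs)  uniq = attach-all p (inj₂ mi) xs uniq

module _ {V : Set} where

  module Wrap (u : V) (ts : List V) where

    wrap : List V → ℕ → V
    wrap []       zero    = u
    wrap []       (suc i) = wrap ts i
    wrap (x ∷ xs) zero    = x
    wrap (x ∷ xs) (suc i) = wrap xs i

    wrap-+ : ∀ xs i → wrap xs (length xs + i) ≡ wrap [] i
    wrap-+ []       i = refl
    wrap-+ (x ∷ xs) i = wrap-+ xs i

    wrap-range : ∀ xs → range (wrap xs) 0 (length xs) ≡ xs
    wrap-range []       = refl
    wrap-range (x ∷ xs) = cong (x ∷_) (trans (sym (range-shift (wrap (x ∷ xs)) 1 0 (length xs))) (wrap-range xs))

    module _ {E : V → V → Set} (linked : Linked E ((u ∷ ts) ++ u ∷ [])) where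

      wrap-step : ∀ xs → Linked E (xs ++ u ∷ []) → ∀ i → E (wrap xs i) (wrap xs (suc i))
      wrap-step [] _ zero = start ts linked
        where
        start : ∀ xs → Linked E (u ∷ xs ++ u ∷ []) → E u (wrap xs 0)
        start []      (e ∷ _) = e
        start (_ ∷ _) (e ∷ _) = e
      wrap-step [] _ (suc i)                       = wrap-step ts (Linked.tail linked) i
      wrap-step (x ∷ []) (e ∷ _) zero              = e
      wrap-step (x ∷ y ∷ xs) (e ∷ _) zero          = e
      wrap-step (x ∷ xs) l (suc i)                 = wrap-step xs (Linked.tail l) i

  -- In the application isR v means that both ends of a red path outside S are joined to v in red.
  module Circuits
    {R B : V → V → Set} (R-sym : ∀ {u v} → R u v → R v u) (B-sym : ∀ {u v} → B u v → B v u)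
    (total : ∀ u v → R u v ⊎ B u v)
    {S : List V} (S-unique : Unique S)
    (isR notR : V → Set) (isR? : ∀ v → isR v ⊎ notR v)
    (ham-end-isR : ∀ {u v} → Path B u v S → notR u → notR v → ⊥)
    (skip : ∀ {r u v S′} → S ↭ r ∷ S′ → isR r → Path B u v S′ → R u v)
    (no-ham-R : ∀ {u v} → Path R u v S → isR u → isR v → ⊥)
    where

    record Circuit (N : ℕ) : Set where
      field
        at     : ℕ → V
        period : ∀ i → at (N + i) ≡ at i
        step   : ∀ i → B (at i) (at (suc i))
        cover  : S ↭ range at 0 N

    closed⇒circuit : ∀ {u v} → Path B u v S → B v u → Circuit (length S)
    closed⇒circuit {u} p vu with vertices p
    ... | ts , σ , link = subst Circuit (↭-length σ) record
      { at     = wrap (u ∷ ts)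
      ; period = λ i → trans (wrap-+ (u ∷ ts) i) (again i)
      ; step   = wrap-step linked (u ∷ ts) linked
      ; cover  = ↭-trans (↭-sym σ) (↭-reflexive (sym (wrap-range (u ∷ ts))))
      }
      where
      open Wrap u ts
      linked = link vu [-]
      again : ∀ i → wrap [] i ≡ wrap (u ∷ ts) i
      again zero    = refl
      again (suc i) = refl

    shift-circuit : ∀ {N} → ℕ → Circuit N → Circuit N
    shift-circuit {N} s w = record
      { at     = λ i → at (s + i)
      ; period = λ i → trans (cong at (lemma s N i)) (period (s + i))
      ; step   = λ i → subst (λ j → B (at (s + i)) (at j)) (sym (+-suc s i)) (step (s + i))
      ; cover  = ↭-trans cover (↭-trans (Periodic.range-start at N period (s + 0))
                   (↭-reflexive (sym (range-shift at s 0 N))))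
      }
      where
      open Circuit w
      lemma : ∀ a b c → a + (b + c) ≡ b + (a + c)
      lemma = solve-∀

    module CircuitFacts {n} (w : Circuit (2 + n)) where
      open Circuit w public
      N = 2 + n
      open Periodic at N period public

      from : ∀ i → S ↭ range at i N
      from i = ↭-trans cover (range-start i)

      isR-next : ∀ i → notR (at i) → isR (at (suc i))
      isR-next i ni with isR? (at (suc i))
      ... | inj₁ r  = r
      ... | inj₂ nr = ⊥-elim (ham-end-isR
        (reorder (↭-sym (from (suc i)))
          (castEnd (trans (cong at (+-suc (suc n) i)) (period i)) (segment at step (suc i) (suc n))))
        nr ni)

      isR-prev : ∀ i → notR (at (suc i)) → isR (at i)
      isR-prev i nr with isR? (at i)
      ... | inj₁ r  = r
      ... | inj₂ ni = ⊥-elim (ham-end-isR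
        (reorder (↭-sym (from (suc i)))
          (castEnd (trans (cong at (+-suc (suc n) i)) (period i)) (segment at step (suc i) (suc n))))
        nr ni)

      two-step : ∀ i → isR (at (suc i)) → R (at i) (at (2 + i))
      two-step i r = R-sym (skip (from (suc i)) r
        (castEnd (trans (cong at (trans (+-suc n (suc i)) (cong suc (+-suc n i)))) (period i))
          (segment at step (2 + i) n)))

      plus-lt : ∀ i d e → suc n ≡ suc d + e → notR (at i) → notR (at (suc d + i)) →
        R (at (suc i)) (at (suc (suc d + i)))
      plus-lt i d e eq ni nj with total (at (suc i)) (at (suc (suc d + i)))
      ... | inj₁ r = r
      ... | inj₂ b = ⊥-elim (ham-end-isR
        (reorder (↭-trans (↭-reflexive (trans (sym (trans (range-++ at (suc d) (suc e) {suc i})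
                      (cong (λ j → range at (suc i) (suc d) ++ range at j (suc e)) (+-suc (suc d) i))))
                    (cong (range at (suc i)) (trans (+-suc (suc d) e) (cong suc (sym eq))))))
                    (↭-sym (from (suc i))))
          (castEnd (trans (cong at (lemma e d i)) (trans (cong (λ m → at (suc m + i)) (sym eq)) (period i)))
            (join (reverse B-sym (segment at step (suc i) d)) b (segment at step (suc (suc d + i)) e))))
        (subst (notR ∘ at) (sym (+-suc d i)) nj) ni)
        where
        lemma : ∀ e d i → e + suc (suc d + i) ≡ suc (suc d + e) + i
        lemma = solve-∀

      minus-lt : ∀ i d e → suc n ≡ suc d + e → notR (at (suc i)) → notR (at (suc (suc d + i))) →
        R (at i) (at (suc d + i))
      minus-lt i d e eq ni nj with total (at i) (at (suc d + i))
      ... | inj₁ r = r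
      ... | inj₂ b = ⊥-elim (ham-end-isR
        (reorder (↭-trans (↭-reflexive (trans (sym (trans (range-++ at (suc d) (suc e) {suc i})
                      (cong (λ j → range at (suc i) (suc d) ++ range at j (suc e)) (+-suc (suc d) i))))
                    (cong (range at (suc i)) (trans (+-suc (suc d) e) (cong suc (sym eq))))))
                    (↭-sym (from (suc i))))
          (join (castEnd (cong at (+-suc d i)) (segment at step (suc i) d)) (B-sym b)
            (reverse B-sym
              (castEnd (trans (cong at (lemma e d i)) (trans (cong (λ m → at (suc m + i)) (sym eq)) (period i)))
                (segment at step (suc (suc d + i)) e)))))
        ni nj)
        where
        lemma : ∀ e d i → e + suc (suc d + i) ≡ suc (suc d + e) + i
        lemma = solve-∀

      Plus Minus : V → Set
      Plus  = Labelled (notR ∘ at) (at ∘ suc) (suc n)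
      Minus = Labelled (notR ∘ at ∘ suc) at (suc n)

      plus⇒isR : ∀ {v} → Plus v → isR v
      plus⇒isR (i , _ , ni , refl) = isR-next i ni

      minus⇒isR : ∀ {v} → Minus v → isR v
      minus⇒isR (i , _ , ni , refl) = isR-prev i ni

      no-strands : ∀ {s T} → Strands R Plus Minus s T → T ↭ S → ⊥
      no-strands xs σ with strands⇒path R-sym (labelled-clique R-sym plus-lt) (labelled-clique R-sym minus-lt) xs (unique-↭ (↭-sym σ) S-unique)
      ... | e , p , inj₁ pl = no-ham-R (reorder σ p) (plus⇒isR (strands-plus xs)) (plus⇒isR pl)
      ... | e , p , inj₂ mi = no-ham-R (reorder σ p) (plus⇒isR (strands-plus xs)) (minus⇒isR mi)

      no-odd : ∀ h → N ≡ suc (double h) → (∀ t → t < double h → isR (at (suc t))) → ⊥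
      no-odd zero    () _
      no-odd (suc h) eq r = no-ham-R
        (reorder (↭-trans (interleave-odd (at ∘ suc) 0 (suc h))
            (↭-trans (↭-reflexive (trans (range-shift at 1 0 _) (cong (range at 1) (sym eq)))) (↭-sym (from 1))))
          (join (segment≤ (at ∘ suc ∘ double) 0 (suc h)
                   λ t t≤h → subst (λ j → R (at (suc (double j))) (at (suc (suc (suc (double j)))))) (sym (+-identityʳ t))
                     (two-step (suc (double t)) (r (suc (double t)) (double-mono-< t≤h))))
            (subst (λ v → R v (at 2)) (sym wraps) (two-step 0 (r 0 (s≤s z≤n))))
            (segment≤ (at ∘ suc ∘ suc ∘ double) 0 h
                   λ t t<h → subst (λ j → R (at (2 + (double j))) (at (4 + (double j)))) (sym (+-identityʳ t))
                     (two-step (2 + double t) (r (2 + double t) (s≤s (s≤s (≤-trans (n≤1+n _) (double-mono-< t<h))))))))) 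
        (r 0 (s≤s z≤n))
        (subst (λ j → isR (at (2 + double j))) (sym (+-identityʳ h)) (r (suc (double h)) ≤-refl))
        where
        wraps : at (suc (double (suc h + 0))) ≡ at 0
        wraps = trans (cong (at ∘ suc ∘ double) (+-identityʳ (suc h)))
                  (trans (cong at (sym (trans (+-identityʳ N) eq))) (period 0))

      Open : ℕ → List V → Set
      Open i T = ∃[ s ] Plus s × Path R s (at i) T

      -- Reading the circuit from position 2 + t on, two strands are open: one ends at the
      -- last vertex read, the other at the one before.  A vertex of notR closes the latter.
      collect : ∀ {T S₁ S₂ v} → Path R (at 0) v T → Minus v → notR (at 0) →
        ∀ f t → N ≡ f + (2 + t) → Open (suc t) S₁ → Open t S₂ →
        ∃[ s ] ∃[ U ] Strands R Plus Minus s U × U ↭ S₁ ++ S₂ ++ range at (2 + t) f ++ T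
      collect {T} {S₁} {S₂} p mi n0 zero t eq (s₁ , pl₁ , p₁) (s₂ , pl₂ , p₂) =
        _ , _ , strand pl₁ (suc t , ≤-reflexive (sym eq) , last , refl) p₁
              ∷ one (strand pl₂ mi (join p₂ (subst (R (at t)) wraps (two-step t (isR-prev (suc t) last))) p)) ,
        ↭-refl
        where
        wraps : at (2 + t) ≡ at 0
        wraps = trans (cong at (sym (trans (+-identityʳ N) eq))) (period 0)
        last : notR (at (2 + t))
        last = subst notR (sym wraps) n0
      collect {T} {S₁} {S₂} p mi n0 (suc f) t eq A@(s₁ , pl₁ , p₁) (s₂ , pl₂ , p₂) with isR? (at (suc t))
      ... | inj₁ r with collect p mi n0 f (suc t) (trans eq (sym (+-suc f (2 + t))))
                          (s₂ , pl₂ , join p₂ (two-step t r) [ _ ]) A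
      ...   | s , U , xs , σ = s , U , xs , ↭-trans σ
        (solve 5 (λ a b c d e → (b ⊕ c) ⊕ a ⊕ d ⊕ e ⊜ a ⊕ b ⊕ (c ⊕ d) ⊕ e) ↭-refl
          S₁ S₂ (at (2 + t) ∷ []) (range at (3 + t) f) T)
      collect {T} {S₁} {S₂} p mi n0 (suc f) t eq A@(s₁ , pl₁ , p₁) (s₂ , pl₂ , p₂) | inj₂ nr
        with collect p mi n0 f (suc t) (trans eq (sym (+-suc f (2 + t))))
               (_ , (suc t , ≤-trans (s≤s (n≤1+n _)) bound , nr , refl) , [ at (2 + t) ]) A
        where
        bound : 3 + t ≤ N
        bound = ≤-trans (m≤n+m (3 + t) f) (≤-reflexive (sym (trans eq (sym (+-suc f (2 + t))))))
      ...   | s , U , xs , σ =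
        _ , _ , strand pl₂ (t , ≤-trans (s≤s (≤-trans (n≤1+n _) (n≤1+n _))) bound , nr , refl) p₂ ∷ xs ,
        ↭-trans (++⁺ˡ S₂ σ)
          (solve 5 (λ a b c d e → b ⊕ c ⊕ a ⊕ d ⊕ e ⊜ a ⊕ b ⊕ (c ⊕ d) ⊕ e) ↭-refl
            S₁ S₂ (at (2 + t) ∷ []) (range at (3 + t) f) T)
        where
        bound : 3 + t ≤ N
        bound = ≤-trans (m≤n+m (3 + t) f) (≤-reflexive (sym (trans eq (sym (+-suc f (2 + t))))))

      even-run-then-more : ∀ h f → N ≡ f + (2 + suc (double h)) →
        notR (at 0) → (∀ t → t < double h → isR (at (suc t))) → notR (at (suc (double h))) → ⊥
      even-run-then-more h f eq n0 r nD
        with collect even-path minus n0 f (suc (double h)) eq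
               (_ , (suc (double h) , D<N , nD , refl) , [ _ ]) (_ , (0 , s≤s z≤n , n0 , refl) , odd-path)
        where
        D<N : suc (double h) < N
        D<N = ≤-trans (n≤1+n _) (≤-trans (m≤n+m _ f) (≤-reflexive (sym eq)))
        odd-path : Path R (at 1) (at (suc (double h))) (range (at ∘ suc ∘ double) 0 (suc h))
        odd-path = castEnd (cong (at ∘ suc ∘ double) (+-identityʳ h))
          (segment≤ (at ∘ suc ∘ double) 0 h λ t t<h →
            subst (λ j → R (at (suc (double j))) (at (suc (suc (suc (double j)))))) (sym (+-identityʳ t))
              (two-step (suc (double t)) (r (suc (double t)) (double-mono-< t<h))))
        even-path : Path R (at 0) (at (double h)) (range (at ∘ double) 0 (suc h))
        even-path = castEnd (cong (at ∘ double) (+-identityʳ h))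
          (segment≤ (at ∘ double) 0 h λ t t<h →
            subst (λ j → R (at (double j)) (at (suc (suc (double j))))) (sym (+-identityʳ t))
              (two-step (double t) (r (double t) (≤-trans (n≤1+n _) (double-mono-< t<h)))))
        minus : Minus (at (double h))
        minus = double h , ≤-trans (n≤1+n _) D<N , nD , refl
      ... | s , U , xs , σ = no-strands xs
        (↭-trans σ (↭-trans
          (solve 4 (λ a b c d → a ⊕ b ⊕ c ⊕ d ⊜ (d ⊕ b) ⊕ a ⊕ c) ↭-refl
            (at (2 + double h) ∷ []) (range (at ∘ suc ∘ double) 0 (suc h)) (range at (3 + double h) f)
            (range (at ∘ double) 0 (suc h)))
        (↭-trans (++⁺ʳ _ (interleave at 0 (suc h)))
        (↭-trans (↭-reflexive (trans
                   (cong (λ j → range at 0 (2 + double h) ++ range at j (suc f)) (sym (+-identityʳ (2 + double h))))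
                   (trans (sym (range-++ at (2 + double h) (suc f)))
                     (cong (range at 0) (trans (lemma (double h) f) (sym eq))))))
          (↭-sym cover)))))
        where
        lemma : ∀ a f → 2 + a + suc f ≡ f + (3 + a)
        lemma = solve-∀

      no-even-run : ∀ h → notR (at 0) → (∀ t → t < double h → isR (at (suc t))) → notR (at (suc (double h))) →
        suc (double h) ≤ N → ⊥
      no-even-run h n0 r nD D≤N with m≤n⇒∃[o]m+o≡n D≤N
      ... | zero , eq = no-odd h (trans (sym eq) (+-identityʳ _)) r
      ... | suc zero , eq = ham-end-isR
        (reorder (↭-trans (↭-reflexive (cong (range at 0) (trans (+-comm 1 _) eq))) (↭-sym cover))
          (castEnd (cong at (+-identityʳ _)) (segment at step 0 (suc (double h))))) n0 nD
      ... | suc (suc f) , eq = even-run-then-more h f (trans (sym eq) (lemma f (double h))) n0 r nD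
        where
        lemma : ∀ f d → suc d + (2 + f) ≡ f + (3 + d)
        lemma = solve-∀

    module _ {n : ℕ} where

      even-run-search : ∀ i (w : Circuit (2 + n)) a → notR (Circuit.at w 0) →
        (∀ t → t < double a → isR (Circuit.at w (suc t))) → notR (Circuit.at w (suc (double (a + i)))) →
        suc (double (a + i)) ≤ 2 + n → ⊥
      even-run-search zero w a n0 r nD D≤N rewrite +-identityʳ a = CircuitFacts.no-even-run w a n0 r nD D≤N
      even-run-search (suc i) w a n0 r nD D≤N
        with isR? (at (suc (double a))) | isR? (at (2 + double a))
        where open Circuit w
      ... | inj₂ nr | _ = CircuitFacts.no-even-run w a n0 r nr
        (≤-trans (s≤s (≤-trans (m≤m+n (double a) (double (suc i))) (≤-reflexive (sym (double-+ a (suc i)))))) D≤N)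
      ... | inj₁ r₁ | inj₂ nr = even-run-search i (shift-circuit (2 + double a) w) 0
        (subst (notR ∘ at) (sym (+-identityʳ _)) nr) (λ _ ())
        (subst (notR ∘ at) eq nD)
        (≤-trans (s≤s (≤-trans (≤-trans (≤-trans (n≤1+n _) (n≤1+n _)) (m≤n+m (2 + double i) (double a)))
          (≤-reflexive (sym (double-+ a (suc i)))))) D≤N)
        where
        open Circuit w
        eq : suc (double (a + suc i)) ≡ 2 + double a + suc (double i)
        eq = trans (cong suc (double-+ a (suc i))) (lemma (double a) (double i))
          where
          lemma : ∀ a i → suc (a + suc (suc i)) ≡ suc (suc (a + suc i))
          lemma = solve-∀
      ... | inj₁ r₁ | inj₁ r₂ = even-run-search i w (suc a) n0 run
        (subst (notR ∘ at ∘ suc ∘ double) (+-suc a i) nD)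
        (subst (λ j → suc (double j) ≤ 2 + n) (+-suc a i) D≤N)
        where
        open Circuit w
        run : ∀ t → t < double (suc a) → isR (at (suc t))
        run t t< with <-cmp t (double a)
        ... | tri< t<a _ _ = r t t<a
        ... | tri≈ _ refl _ = r₁
        run t (s≤s t≤) | tri> _ _ a<t with refl ← ≤-antisym t≤ a<t = r₂

    data Outcome (N : ℕ) : Set where
      alternating : ∀ k → N ≡ double k → (w : Circuit N) → (∀ i → isR (Circuit.at w (suc (double i)))) →
        notR (Circuit.at w 0) ⊎ (∀ i → isR (Circuit.at w i)) → Outcome N

    odd-everywhere : ∀ {n} (w : Circuit (2 + n)) k → 2 + n ≡ double k →
      (∀ i → i < k → isR (Circuit.at w (suc (double i)))) → ∀ i → isR (Circuit.at w (suc (double i)))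
    odd-everywhere {n} w (suc k) eq = Periodic.everywhere (at ∘ suc ∘ double) (suc k)
      (λ i → trans (cong (at ∘ suc) (trans (double-+ (suc k) i) (cong (_+ double i) (sym eq))))
               (trans (cong at (sym (+-suc (2 + n) (double i)))) (period (suc (double i))))) {P = isR}
      where open Circuit w

    classify : ∀ {n} → Circuit (2 + n) → Outcome (2 + n)
    classify {n} w with all-below? (λ i → isR? (Circuit.at w i)) (2 + n) | even-or-odd (2 + n)
    ... | inj₁ r | inj₂ (h , eq) = ⊥-elim (CircuitFacts.no-odd w h eq
      λ t t<h → r (suc t) (≤-trans (s≤s t<h) (≤-reflexive (sym eq))))
    ... | inj₁ r | inj₁ (k , eq) = alternating k eq w (λ i → everywhere {P = isR} r (suc (double i)))
      (inj₂ (everywhere {P = isR} r))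
      where open CircuitFacts w
    ... | inj₂ (s , _ , ns) | inj₂ (h , eq) = ⊥-elim (even-run-search h w′ 0 n0 (λ _ ())
        (subst notR (trans (sym (period 0)) (cong at (trans (+-identityʳ N) eq))) n0)
        (≤-reflexive (sym eq)))
      where
      w′ = shift-circuit s w
      open CircuitFacts w′
      n0 : notR (at 0)
      n0 = subst (notR ∘ Circuit.at w) (sym (+-identityʳ s)) ns
    ... | inj₂ (s , _ , ns) | inj₁ (k , eq)
      with all-below? (λ i → isR? (Circuit.at (shift-circuit s w) (suc (double i)))) k
    ...   | inj₂ (i , i<k , nr) = ⊥-elim (even-run-search i (shift-circuit s w) 0
        (subst (notR ∘ Circuit.at w) (sym (+-identityʳ s)) ns) (λ _ ()) nr
        (≤-trans (≤-trans (n≤1+n _) (double-mono-< i<k)) (≤-reflexive (sym eq))))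
    ...   | inj₁ r = alternating k eq w′ odd
        (inj₁ (subst (notR ∘ Circuit.at w) (sym (+-identityʳ s)) ns))
      where
      w′ = shift-circuit s w
      odd : ∀ i → isR (Circuit.at w′ (suc (double i)))
      odd = odd-everywhere w′ k eq r

module _ {V : Set} where

  -- K ≡ -1 modulo the period, so multiplying the index by K reverses the cycle.
  range-mirror : ∀ (f : ℕ → V) K (per : ∀ i → f (suc K + i) ≡ f i) →
    range (λ i → f (K * i)) 0 (suc K) ↭ range f 0 (suc K)
  range-mirror f K per =
    ↭-trans (Periodic.range-start (λ i → f (K * i)) (suc K) per′ 1) (down (suc K) 1 refl)
    where
    open Periodic f (suc K) per
    per′ : ∀ i → f (K * (suc K + i)) ≡ f (K * i)
    per′ i = trans (cong f (lemma K i)) (multiple K (K * i))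
      where
      lemma : ∀ K i → K * (suc K + i) ≡ K * suc K + K * i
      lemma = solve-∀
    flip : ∀ i j → i + j ≡ suc K → f (K * i) ≡ f j
    flip i j eq = trans (sym (per (K * i))) (trans (cong (λ n → f (n + K * i)) (sym eq))
      (trans (cong f (lemma K i j)) (multiple i j)))
      where
      lemma : ∀ K i j → i + j + K * i ≡ i * suc K + j
      lemma = solve-∀
    down : ∀ m i → i + m ≡ suc (suc K) → range (λ i → f (K * i)) i m ↭ range f 0 m
    down zero    i eq = ↭-refl
    down (suc m) i eq = ↭-trans
      (prep _ (down m (suc i) (trans (sym (+-suc i m)) eq)))
      (↭-trans (↭-reflexive (cong (_∷ range f 0 m) (flip i m (suc-injective (trans (sym (+-suc i m)) eq)))))
        (↭-trans (++-comm (f m ∷ []) (range f 0 m))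
          (↭-reflexive (trans (cong (λ j → range f 0 m ++ range f j 1) (sym (+-identityʳ m)))
            (trans (sym (range-++ f m 1)) (cong (range f 0) (+-comm m 1)))))))

module _ {V : Set} where

  -- Unlike in a Cycle, two vertices only count as a cycle here if their edge has the right colour.
  data Ring (E : V → V → Set) : List V → Set where
    none   : Ring E []
    single : ∀ v → Ring E (v ∷ [])
    closed : ∀ {u v S} → Path E u v S → E v u → Ring E S

  ring⇒cycle : ∀ {E : V → V → Set} {S} → Ring E S → Cycle E S
  ring⇒cycle none         = none
  ring⇒cycle (single v)   = single v
  ring⇒cycle (closed p e) = closed p e

  PathRing : (A B : V → V → Set) → List V → Set
  PathRing A B X = ∃[ S ] ∃[ T ] MaybePath A S × Ring B T × S ++ T ↭ X

  module _ {A B : V → V → Set} (A-sym : ∀ {u v} → A u v → A v u) (B-sym : ∀ {u v} → B u v → B v u)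
           (total : ∀ u v → A u v ⊎ B u v) where

    linked-paths⇒path-ring : ∀ {a a′ b b′ S T X} → Path A a a′ S → Path B b b′ T → A a′ b → S ++ T ↭ X →
      PathRing A B X ⊎ PathRing B A X
    linked-paths⇒path-ring {a} {a′} {b} {b′} {S} {T} p q e σ with total b a
    ... | inj₁ ba with dropStart q
    ...   | T′ , q′ , τ = inj₂ (T′ , S ++ b ∷ [] , q′ , closed (join p e [ b ]) ba ,
      ↭-trans (solve 3 (λ s t b → t ⊕ s ⊕ b ⊜ s ⊕ b ⊕ t) ↭-refl S T′ (b ∷ []))
        (↭-trans (++⁺ˡ S (↭-sym τ)) σ))
    linked-paths⇒path-ring {a} {a′} {b} {b′} {S} {T} p q e σ | inj₂ ba with total b′ a
    ... | inj₂ b′a with dropStart p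
    ...   | S′ , p′ , τ = inj₁ (S′ , T ++ a ∷ [] , p′ , closed (join q b′a [ a ]) (B-sym ba) ,
      ↭-trans (solve 3 (λ s t a → s ⊕ t ⊕ a ⊜ (a ⊕ s) ⊕ t) ↭-refl S′ T (a ∷ []))
        (↭-trans (++⁺ʳ T (↭-sym τ)) σ))
    linked-paths⇒path-ring {a} {a′} {b} {b′} {S} {T} p q e σ | inj₂ ba | inj₁ b′a with total b′ b
    ... | inj₂ b′b = inj₁ (S , T , some p , closed q b′b , σ)
    ... | inj₁ b′b with uncons q
    ...   | only refl τ = inj₂ ([] , S ++ b ∷ [] , none , closed (join p e [ b ]) b′a , ↭-trans (++⁺ˡ S (↭-sym τ)) σ)
    ...   | more _ q′ τ with dropEnd B-sym q′
    ...     | T′ , q″ , τ′ = inj₂ (T′ , S ++ b ∷ b′ ∷ [] , q″ ,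
      closed (join p e (join [ b ] (A-sym b′b) [ b′ ])) b′a ,
      ↭-trans (solve 4 (λ s t b c → t ⊕ s ⊕ b ⊕ c ⊜ s ⊕ b ⊕ c ⊕ t) ↭-refl S T′ (b ∷ []) (b′ ∷ []))
        (↭-trans (++⁺ˡ S (↭-sym (↭-trans τ (prep b τ′)))) σ))

  paths⇒path-ring : ∀ {A B : V → V → Set} →
    (A-sym : ∀ {u v} → A u v → A v u) (B-sym : ∀ {u v} → B u v → B v u) (total : ∀ u v → A u v ⊎ B u v) →
    ∀ {S T X} → MaybePath A S → MaybePath B T → S ++ T ↭ X → PathRing A B X ⊎ PathRing B A X
  paths⇒path-ring _ _ _ {T = T} none q σ = inj₂ (T , [] , q , none , ↭-trans (++-comm T []) σ)
  paths⇒path-ring _ _ _ {S = S} p none σ = inj₁ (S , [] , p , none , σ)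
  paths⇒path-ring A-sym B-sym total {S} {T} (some {a} {a′} p) (some {b} {b′} q) σ with total a′ b
  ... | inj₁ e = linked-paths⇒path-ring A-sym B-sym total p q e σ
  ... | inj₂ e with linked-paths⇒path-ring B-sym A-sym (λ u v → Sum.swap (total u v))
                      (reverse B-sym q) (reverse A-sym p) (B-sym e) (↭-trans (++-comm T S) σ)
  ...   | inj₁ r = inj₂ r
  ...   | inj₂ r = inj₁ r

  module Colouring
    {R B : V → V → Set}
    (R-sym : ∀ {u v} → R u v → R v u) (B-sym : ∀ {u v} → B u v → B v u)
    (total : ∀ u v → R u v ⊎ B u v) (exclusive : ∀ {u v} → R u v → B u v → ⊥)
    (X : List V)
    (no-cycles : ∀ {S T} → Cycle R S → Cycle B T → S ++ T ↭ X → ⊥)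
    (m : ℕ)
    (no-shorter-R : ∀ {S T} → MaybePath R S → length S < m → Ring B T → S ++ T ↭ X → ⊥)
    (no-shorter-B : ∀ {S T} → MaybePath B S → length S < m → Ring R T → S ++ T ↭ X → ⊥)
    where

    ¬B⇒R : ∀ {u v} → (B u v → ⊥) → R u v
    ¬B⇒R {u} {v} ¬b with total u v
    ... | inj₁ r = r
    ... | inj₂ b = ⊥-elim (¬b b)

    ¬R⇒B : ∀ {u v} → (R u v → ⊥) → B u v
    ¬R⇒B {u} {v} ¬r with total u v
    ... | inj₁ r = ⊥-elim (¬r r)
    ... | inj₂ b = b

    module End {x p y J S} (xp : R x p) (P : Path R p y J) (len : length (x ∷ J) ≡ m)
               (part : (x ∷ J) ++ S ↭ X) where

      -- If p c were red, c could take the place of x on the path, closing it, and x that of c on the cycle.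
      exchange : ∀ {c u v S′} → S ↭ c ∷ S′ → Path B u v S′ → B x u → B x v → R y c → B p c
      exchange {c} {u} {v} {S′} σ Q xu xv yc = ¬R⇒B λ pc →
        no-cycles (closed (join P yc [ c ]) (R-sym pc)) (closed (join [ x ] xu Q) (B-sym xv))
          (↭-trans (solve 4 (λ x j c s → (j ⊕ c) ⊕ x ⊕ s ⊜ (x ⊕ j) ⊕ c ⊕ s) ↭-refl (x ∷ []) J (c ∷ []) S′)
            (↭-trans (++⁺ˡ (x ∷ J) (↭-sym σ)) part))

      exchanged : ∀ {c u v S′} → S ↭ c ∷ S′ → Path B u v (x ∷ S′) → B p c → B v c → R p u
      exchanged {c} {u} {v} {S′} σ Q pc vc with dropStart P
      ... | J′ , P′ , τ = ¬B⇒R λ pu →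
        no-shorter-R P′ (subst (length J′ <_) (trans (cong suc (sym (↭-length τ))) len) (n≤1+n _))
          (closed (join Q vc (join [ c ] (B-sym pc) [ p ])) pu)
          (↭-trans (solve 5 (λ x p j c s → j ⊕ (x ⊕ s) ⊕ c ⊕ p ⊜ (x ⊕ p ⊕ j) ⊕ c ⊕ s) ↭-refl (x ∷ []) (p ∷ []) J′ (c ∷ []) S′)
            (↭-trans (++⁺ (prep x (↭-sym τ)) (↭-sym σ)) part))

    module Pair {x p p′ y I S} (xp : R x p) (P : Path R p p′ I) (p′y : R p′ y) (xy : B x y)
               (len : 2 + length I ≡ m) (part : (x ∷ y ∷ I) ++ S ↭ X) (S-unique : Unique S) where

      isR : V → Set
      isR v = R x v × R y v

      notR : V → Set
      notR v = B x v ⊎ B y v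

      isR? : ∀ v → isR v ⊎ notR v
      isR? v with total x v | total y v
      ... | inj₂ b | _      = inj₂ (inj₁ b)
      ... | inj₁ r | inj₂ b = inj₂ (inj₂ b)
      ... | inj₁ r | inj₁ s = inj₁ (r , s)

      whole : Path R x y (x ∷ I ++ y ∷ [])
      whole = join [ x ] xp (join P p′y [ y ])

      -- Otherwise x, y or both can be moved from the path into the cycle.
      ham-end-isR : ∀ {u v} → Path B u v S → notR u → notR v → ⊥
      ham-end-isR Q (inj₁ xu) (inj₁ xv) =
        no-shorter-R (some (join P p′y [ y ]))
          (≤-reflexive (trans (cong suc (↭-length (++-comm I (y ∷ [])))) len))
          (closed (join Q (B-sym xv) [ x ]) xu)
          (↭-trans (solve 4 (λ x y i s → (i ⊕ y) ⊕ s ⊕ x ⊜ (x ⊕ y ⊕ i) ⊕ s) ↭-refl (x ∷ []) (y ∷ []) I S) part)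
      ham-end-isR Q (inj₂ yu) (inj₂ yv) =
        no-shorter-R (some (join [ x ] xp P)) (≤-reflexive len)
          (closed (join Q (B-sym yv) [ y ]) yu)
          (↭-trans (solve 4 (λ x y i s → (x ⊕ i) ⊕ s ⊕ y ⊜ (x ⊕ y ⊕ i) ⊕ s) ↭-refl (x ∷ []) (y ∷ []) I S) part)
      ham-end-isR Q (inj₁ xu) (inj₂ yv) =
        no-shorter-R (some P) (≤-trans (n≤1+n _) (≤-reflexive len))
          (closed (join Q (B-sym yv) (join [ y ] (B-sym xy) [ x ])) xu)
          (↭-trans (solve 4 (λ x y i s → i ⊕ s ⊕ y ⊕ x ⊜ (x ⊕ y ⊕ i) ⊕ s) ↭-refl (x ∷ []) (y ∷ []) I S) part)
      ham-end-isR Q (inj₂ yu) (inj₁ xv) =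
        no-shorter-R (some P) (≤-trans (n≤1+n _) (≤-reflexive len))
          (closed (join Q (B-sym xv) (join [ x ] xy [ y ])) yu)
          (↭-trans (solve 4 (λ x y i s → i ⊕ s ⊕ x ⊕ y ⊜ (x ⊕ y ⊕ i) ⊕ s) ↭-refl (x ∷ []) (y ∷ []) I S) part)

      absorb : ∀ {u v T S′} → S ↭ T ++ S′ → Path R u v T → R x u → R y v → Cycle B S′ → ⊥
      absorb {T = T} {S′ = S′} σ Q xu yv C =
        no-cycles (closed (join whole yv (reverse R-sym Q)) (R-sym xu)) C
          (↭-trans (solve 5 (λ x y i t s → ((x ⊕ i ⊕ y) ⊕ t) ⊕ s ⊜ (x ⊕ y ⊕ i) ⊕ t ⊕ s) ↭-refl (x ∷ []) (y ∷ []) I T S′)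
            (↭-trans (++⁺ˡ (x ∷ y ∷ I) (↭-sym σ)) part))

      absorb-one : ∀ {r S′} → S ↭ r ∷ S′ → isR r → Cycle B S′ → ⊥
      absorb-one {r} σ (xr , yr) C = absorb {T = r ∷ []} σ [ r ] xr yr C

      skip : ∀ {r u v S′} → S ↭ r ∷ S′ → isR r → Path B u v S′ → R u v
      skip σ r Q = ¬B⇒R λ uv → absorb-one σ r (closed Q (B-sym uv))

      module X-end = End xp (join P p′y [ y ])
        (trans (cong suc (↭-length (++-comm I (y ∷ [])))) len)
        (↭-trans (++⁺ʳ S (prep x (++-comm I (y ∷ [])))) part)

      module Y-end = End (R-sym p′y) (reverse R-sym (join [ x ] xp P))
        len (↭-trans (swap y x ↭-refl) part)

      absorb-end : ∀ {u v T S′} → S ↭ T ++ S′ → Path R u v T → isR u → R x v ⊎ R y v → Cycle B S′ → ⊥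
      absorb-end σ Q (xu , _) (inj₂ yv) C = absorb σ Q xu yv C
      absorb-end σ Q (_ , yu) (inj₁ xv) C = absorb σ (reverse R-sym Q) xv yu C

      -- Alternating cycles

      record Alternating (k : ℕ) : Set where
        field
          y̅ z̅      : ℕ → V
          y-period : ∀ i → y̅ (k + i) ≡ y̅ i
          z-period : ∀ i → z̅ (k + i) ≡ z̅ i
          yz       : ∀ i → B (y̅ i) (z̅ i)
          zy       : ∀ i → B (z̅ i) (y̅ (suc i))
          z-isR    : ∀ i → isR (z̅ i)
          cover    : S ↭ range z̅ 0 k ++ range y̅ 0 k

      shift-alternating : ∀ {k} → ℕ → Alternating k → Alternating k
      shift-alternating {k} s a = record
        { y̅ = λ i → y̅ (s + i)
        ; z̅ = λ i → z̅ (s + i)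
        ; y-period = λ i → trans (cong y̅ (lemma s k i)) (y-period (s + i))
        ; z-period = λ i → trans (cong z̅ (lemma s k i)) (z-period (s + i))
        ; yz = λ i → yz (s + i)
        ; zy = λ i → subst (λ j → B (z̅ (s + i)) (y̅ j)) (sym (+-suc s i)) (zy (s + i))
        ; z-isR = λ i → z-isR (s + i)
        ; cover = ↭-trans cover (++⁺
            (↭-trans (Periodic.range-start z̅ k z-period (s + 0)) (↭-reflexive (sym (range-shift z̅ s 0 k))))
            (↭-trans (Periodic.range-start y̅ k y-period (s + 0)) (↭-reflexive (sym (range-shift y̅ s 0 k)))))
        }
        where
        open Alternating a
        lemma : ∀ a b c → a + (b + c) ≡ b + (a + c)
        lemma = solve-∀

      mirror : ∀ {K} → Alternating (suc K) → Alternating (suc K)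
      mirror {K} a = record
        { y̅ = λ i → y̅ (K * i)
        ; z̅ = λ i → z̅ (K * suc i)
        ; y-period = λ i → trans (cong y̅ (lemma K i)) (Periodic.multiple y̅ (suc K) y-period K (K * i))
        ; z-period = λ i → trans (cong z̅ (lemma′ K i)) (Periodic.multiple z̅ (suc K) z-period K (K * suc i))
        ; yz = λ i → B-sym (subst (B (z̅ (K * suc i))) (trans (cong y̅ (lemma″ K i)) (y-period (K * i))) (zy (K * suc i)))
        ; zy = λ i → B-sym (yz (K * suc i))
        ; z-isR = λ i → z-isR (K * suc i)
        ; cover = ↭-trans cover (++⁺
            (↭-sym (↭-trans (↭-reflexive (range-shift (λ i → z̅ (K * i)) 1 0 (suc K)))
              (↭-trans (Periodic.range-rotate (λ i → z̅ (K * i)) (suc K)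
                 (λ i → trans (cong z̅ (lemma K i)) (Periodic.multiple z̅ (suc K) z-period K (K * i))) 0)
                (range-mirror z̅ K z-period))))
            (↭-sym (range-mirror y̅ K y-period)))
        }
        where
        open Alternating a
        lemma : ∀ K i → K * (suc K + i) ≡ K * suc K + K * i
        lemma = solve-∀
        lemma′ : ∀ K i → K * suc (suc K + i) ≡ K * suc K + K * suc i
        lemma′ = solve-∀
        lemma″ : ∀ K i → suc (K * suc i) ≡ suc K + K * i
        lemma″ = solve-∀

      module AlternatingFacts {k′} (a : Alternating (2 + k′)) where
        open Alternating a public
        k = 2 + k′
        module Y = Periodic y̅ k y-period
        module Z = Periodic z̅ k z-period

        covers : ∀ i j → S ↭ range z̅ i k ++ range y̅ j k
        covers i j = ↭-trans cover (++⁺ (Z.range-start i) (Y.range-start j))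

        z→y : ∀ i n → Path B (z̅ i) (y̅ (suc n + i)) (range z̅ i (suc n) ++ range y̅ (suc i) (suc n))
        z→y i zero    = join [ z̅ i ] (zy i) [ y̅ (suc i) ]
        z→y i (suc n) = reorder
          (solve 4 (λ a b c d → a ⊕ b ⊕ c ⊕ d ⊜ (a ⊕ c) ⊕ b ⊕ d) ↭-refl
            (z̅ i ∷ []) (y̅ (suc i) ∷ []) (range z̅ (suc i) (suc n)) (range y̅ (suc (suc i)) (suc n)))
          (castEnd (cong y̅ (+-suc (suc n) i))
            (join [ z̅ i ] (zy i) (join [ y̅ (suc i) ] (yz (suc i)) (z→y (suc i) n))))

        y→z : ∀ i n → Path B (y̅ i) (z̅ (n + i)) (range z̅ i (suc n) ++ range y̅ i (suc n))
        y→z i zero    = reorder (swap _ _ ↭-refl) (join [ y̅ i ] (yz i) [ z̅ i ])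
        y→z i (suc n) = reorder
          (solve 4 (λ a b c d → a ⊕ b ⊕ c ⊕ d ⊜ (b ⊕ c) ⊕ a ⊕ d) ↭-refl
            (y̅ i ∷ []) (z̅ i ∷ []) (range z̅ (suc i) (suc n)) (range y̅ (suc i) (suc n)))
          (castEnd (cong z̅ (+-suc n i))
            (join [ y̅ i ] (yz i) (join [ z̅ i ] (zy i) (y→z (suc i) n))))

        z→z : ∀ i n → Path B (z̅ i) (z̅ (n + i)) (range z̅ i (suc n) ++ range y̅ (suc i) n)
        z→z i zero    = [ z̅ i ]
        z→z i (suc n) = castEnd (cong z̅ (+-suc n i)) (join [ z̅ i ] (zy i) (y→z (suc i) n))

        y→y : ∀ i n → Path B (y̅ i) (y̅ (n + i)) (range z̅ i n ++ range y̅ i (suc n))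
        y→y i zero    = [ y̅ i ]
        y→y i (suc n) = reorder
          (solve 3 (λ a b c → a ⊕ b ⊕ c ⊜ b ⊕ a ⊕ c) ↭-refl
            (y̅ i ∷ []) (range z̅ i (suc n)) (range y̅ (suc i) (suc n)))
          (join [ y̅ i ] (yz i) (z→y i n))

        around : ∀ (f : ℕ → V) → (∀ i → f (k + i) ≡ f i) → ∀ i → f (suc k′ + suc i) ≡ f i
        around f per i = trans (cong f (+-suc (suc k′) i)) (per i)

        without-z : ∀ i → S ↭ z̅ i ∷ range z̅ (suc i) (suc k′) ++ range y̅ (suc i) k
        without-z i = covers i (suc i)

        y-two-step : ∀ i → R (y̅ i) (y̅ (suc i))
        y-two-step i = R-sym (skip (without-z i) (z-isR i) (castEnd (around y̅ y-period i) (y→y (suc i) (suc k′))))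

        z-two-step : ∀ i → isR (y̅ (suc i)) → R (z̅ i) (z̅ (suc i))
        z-two-step i r = R-sym (skip
          (↭-trans (covers (suc i) (suc i)) (shift (y̅ (suc i)) (range z̅ (suc i) k) _))
          r (castEnd (around z̅ z-period i) (z→z (suc i) (suc k′))))

        split-range : ∀ (f : ℕ → V) i d e → suc k′ ≡ suc d + e →
          range f i (suc d) ++ range f (suc d + i) (suc e) ≡ range f i k
        split-range f i d e eq = trans (sym (range-++ f (suc d) (suc e)))
          (cong (range f i) (trans (+-suc (suc d) e) (cong suc (sym eq))))

        split-range′ : ∀ (f : ℕ → V) i d e → suc k′ ≡ suc d + e →
          range f (suc i) (suc d) ++ range f (suc (suc d + i)) (suc e) ≡ range f (suc i) k
        split-range′ f i d e eq = trans (cong (λ j → range f (suc i) (suc d) ++ range f j (suc e)) (sym (+-suc (suc d) i)))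
          (split-range f (suc i) d e eq)

        wrap-index : ∀ i d e → suc k′ ≡ suc d + e → suc e + (suc d + i) ≡ k + i
        wrap-index i d e eq = trans (lemma e d i) (cong (λ n → suc n + i) (sym eq))
          where
          lemma : ∀ e d i → suc e + (suc d + i) ≡ suc (suc d + e) + i
          lemma = solve-∀

        plus-lt : ∀ i d e → suc k′ ≡ suc d + e → notR (y̅ i) → notR (y̅ (suc d + i)) → R (z̅ i) (z̅ (suc d + i))
        plus-lt i d e eq ni nj = ¬B⇒R λ b → ham-end-isR
          (reorder
            (↭-trans (solve 4 (λ a b c d → (a ⊕ b) ⊕ c ⊕ d ⊜ (a ⊕ c) ⊕ b ⊕ d) ↭-refl
                (range z̅ i (suc d)) (range y̅ (suc i) (suc d)) (range z̅ (suc d + i) (suc e)) (range y̅ (suc (suc d + i)) (suc e)))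
              (↭-trans (↭-reflexive (cong₂ _++_ (split-range z̅ i d e eq) (split-range′ y̅ i d e eq)))
                (↭-sym (covers i (suc i)))))
            (castEnd (trans (cong y̅ (wrap-index i d e eq)) (y-period i))
              (join (reverse B-sym (z→y i d)) b (z→y (suc d + i) e))))
          nj ni

        minus-lt : ∀ i d e → suc k′ ≡ suc d + e → notR (y̅ (suc i)) → notR (y̅ (suc (suc d + i))) → R (z̅ i) (z̅ (suc d + i))
        minus-lt i d e eq ni nj = ¬B⇒R λ b → ham-end-isR
          (reorder
            (↭-trans (solve 4 (λ a b c d → (a ⊕ b) ⊕ c ⊕ d ⊜ (a ⊕ c) ⊕ b ⊕ d) ↭-refl
                (range z̅ (suc i) (suc d)) (range y̅ (suc i) (suc d)) (range z̅ (suc (suc d + i)) (suc e)) (range y̅ (suc (suc d + i)) (suc e)))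
              (↭-trans (↭-reflexive (cong₂ _++_ (split-range′ z̅ i d e eq) (split-range′ y̅ i d e eq)))
                (↭-sym (covers (suc i) (suc i)))))
            (join (castEnd (cong z̅ (+-suc d i)) (y→z (suc i) d)) (B-sym b)
              (reverse B-sym (castEnd (trans (cong z̅ (trans (+-suc e (suc d + i)) (wrap-index i d e eq))) (z-period i))
                (y→z (suc (suc d + i)) e)))))
          ni nj

        Plus Minus : V → Set
        Plus  = Labelled (notR ∘ y̅) z̅ (suc k′)
        Minus = Labelled (notR ∘ y̅ ∘ suc) z̅ (suc k′)

        collect : notR (y̅ 0) → ∀ f t {s T} → k ≡ suc f + t → Plus s → Path R s (z̅ t) T →
          ∃[ U ] Strands R Plus Minus s U × U ↭ T ++ range z̅ (suc t) f
        collect n0 zero t {s} {T} eq pl p = T ,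
          one (strand pl (t , ≤-reflexive (sym eq) , subst notR (trans (sym (y-period 0)) (cong y̅ (trans (+-identityʳ k) eq))) n0 , refl) p) ,
          solve 1 (λ t → t ⊜ t ⊕ ∅) ↭-refl T
        collect n0 (suc f) t {s} {T} eq pl p with isR? (y̅ (suc t))
        ... | inj₁ r with collect n0 f (suc t) (trans eq (cong suc (sym (+-suc f t)))) pl (join p (z-two-step t r) [ _ ])
        ...   | U , xs , σ = U , xs ,
          ↭-trans σ (solve 3 (λ a b c → (a ⊕ b) ⊕ c ⊜ a ⊕ b ⊕ c) ↭-refl T (z̅ (suc t) ∷ []) (range z̅ (2 + t) f))
        collect n0 (suc f) t {s} {T} eq pl p | inj₂ nr
          with collect n0 f (suc t) (trans eq (cong suc (sym (+-suc f t))))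
                 (suc t , ≤-trans (m≤n+m _ f) (≤-reflexive (sym (trans eq (lemma f t)))) , nr , refl) [ z̅ (suc t) ]
          where
          lemma : ∀ f t → 2 + f + t ≡ f + (2 + t)
          lemma = solve-∀
        ...   | U , xs , σ = T ++ U ,
          strand pl (t , ≤-trans (m≤n+m _ (suc f)) (≤-reflexive (sym (trans eq (lemma f t)))) , nr , refl) p ∷ xs ,
          ++⁺ˡ T σ
          where
          lemma : ∀ f t → 2 + f + t ≡ suc f + suc t
          lemma = solve-∀

        z-ham : notR (y̅ 0) → ∃[ e ] Path R (z̅ 0) e (range z̅ 0 k) × isR e
        z-ham n0 with collect n0 (suc k′) 0 (sym (+-identityʳ k)) (0 , s≤s z≤n , n0 , refl) [ z̅ 0 ]
        ... | U , xs , σ with strands⇒path R-sym (labelled-clique R-sym plus-lt) (labelled-clique R-sym minus-lt) xs (unique-↭ (↭-sym σ) (unique-++ˡ (range z̅ 0 k) (unique-↭ cover S-unique)))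
        ...   | _ , p , inj₁ (i , _ , _ , refl) = _ , reorder σ p , z-isR i
        ...   | _ , p , inj₂ (i , _ , _ , refl) = _ , reorder σ p , z-isR i

        module Exchange {x₀ p₀ : V}
          (exchange : ∀ {c u v S′} → S ↭ c ∷ S′ → Path B u v S′ → B x₀ u → B x₀ v → isR c → B p₀ c)
          (exchanged : ∀ {c u v S′} → S ↭ c ∷ S′ → Path B u v (x₀ ∷ S′) → B p₀ c → B v c → R p₀ u) where

          exchange-tour : ∀ {i j T} → S ↭ z̅ i ∷ y̅ j ∷ T → Path B (z̅ j) (y̅ i) T → B (y̅ j) (z̅ i) →
            B x₀ (y̅ i) → B x₀ (y̅ j) → B p₀ (z̅ i) × R p₀ (z̅ j)
          exchange-tour {i} {j} {T} σ Q yz′ xi xj = b ,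
            exchanged σ
              (reorder (solve 3 (λ x y t → t ⊕ x ⊕ y ⊜ x ⊕ y ⊕ t) ↭-refl (x₀ ∷ []) (y̅ j ∷ []) T)
                (join Q (B-sym xi) (join [ x₀ ] xj [ y̅ j ]))) b yz′
            where
            b : B p₀ (z̅ i)
            b = exchange σ (join [ y̅ j ] (yz j) Q) xj xi (z-isR i)

          exchange-adjacent : ∀ i → B x₀ (y̅ i) → B x₀ (y̅ (suc i)) → B p₀ (z̅ i) × R p₀ (z̅ (suc i))
          exchange-adjacent i xi xj = exchange-tour {j = suc i}
            (↭-trans (without-z i) (prep _ (shift (y̅ (suc i)) (range z̅ (suc i) (suc k′)) (range y̅ (2 + i) (suc k′)))))
            (castEnd (around y̅ y-period i) (z→y (suc i) k′)) (B-sym (zy i)) xi xj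

          three-consecutive : ∀ i → B x₀ (y̅ i) → B x₀ (y̅ (suc i)) → B x₀ (y̅ (2 + i)) → ⊥
          three-consecutive i b₀ b₁ b₂ =
            exclusive (proj₂ (exchange-adjacent i b₀ b₁)) (proj₁ (exchange-adjacent (suc i) b₁ b₂))

        module ExchangeX = Exchange {x} {p} (λ σ Q xu xv c → X-end.exchange σ Q xu xv (proj₂ c)) X-end.exchanged

        y-segment : ∀ i n → Path R (y̅ i) (y̅ (n + i)) (range y̅ i (suc n))
        y-segment = segment y̅ y-two-step

        -- At most two vertices may be left over: by convention they are a blue cycle.
        z₀-blue : notR (y̅ 0) → ∀ j → B (z̅ 0) (y̅ j)
        z₀-blue n0 j = ¬R⇒B contradiction
          where
          module _ (r : R (z̅ 0) (y̅ j)) where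
            leave : ∀ n S′ → range y̅ j k ≡ range y̅ j (suc n) ++ S′ → Cycle B S′ → B x (y̅ (n + j))
            leave n S′ eq C with z-ham n0
            ... | e , Q , e-isR = ¬R⇒B λ xv → absorb-end
              (↭-trans (covers 0 j) (↭-trans (↭-reflexive (cong (range z̅ 0 k ++_) eq))
                (solve 3 (λ a b c → a ⊕ b ⊕ c ⊜ (a ⊕ b) ⊕ c) ↭-refl (range z̅ 0 k) (range y̅ j (suc n)) S′)))
              (join (reverse R-sym Q) r (y-segment j n)) e-isR (inj₁ xv) C

            tail : ∀ n o → k ≡ suc n + o → range y̅ j k ≡ range y̅ j (suc n) ++ range y̅ (suc n + j) o
            tail n o eq = trans (cong (range y̅ j) eq) (range-++ y̅ (suc n) o)

            last-blue : ∀ n → k ≡ suc n + 0 → B x (y̅ (n + j))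
            last-blue n eq = leave n [] (tail n 0 eq) none

            but-one-blue : ∀ n → k ≡ suc n + 1 → B x (y̅ (n + j))
            but-one-blue n eq = leave n _ (tail n 1 eq) (single _)

            but-two-blue : ∀ n → k ≡ suc n + 2 → B x (y̅ (n + j))
            but-two-blue n eq = leave n _ (tail n 2 eq) (pair _ _)

            contradiction : ⊥
            contradiction = by-size k′ refl
              where
              by-size : ∀ n → k′ ≡ n → ⊥
              by-size zero    refl = ExchangeX.three-consecutive j
                (but-one-blue 0 refl) (last-blue 1 refl)
                (subst (B x) (sym (y-period j)) (but-one-blue 0 refl))
              by-size (suc n) refl = ExchangeX.three-consecutive (n + j)
                (but-two-blue n (lemma n)) (but-one-blue (suc n) (lemma′ n)) (last-blue (2 + n) (lemma″ n))
                where
                lemma : ∀ n → 3 + n ≡ suc n + 2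
                lemma = solve-∀
                lemma′ : ∀ n → 3 + n ≡ 2 + n + 1
                lemma′ = solve-∀
                lemma″ : ∀ n → 3 + n ≡ 3 + n + 0
                lemma″ = solve-∀

      module AlternatingBlue {k′} (a : Alternating (2 + k′)) where
        open AlternatingFacts a

        next-blue : ∀ i → notR (y̅ i) → ∀ j → B (z̅ i) (y̅ j)
        next-blue i ni j = subst (λ u → B u (y̅ j)) (cong z̅ (+-identityʳ i))
          (subst (B (z̅ (i + 0))) (trans (cong y̅ (lemma i (suc k′) j)) (Y.multiple i j))
            (AlternatingFacts.z₀-blue (shift-alternating i a) (subst (notR ∘ y̅) (sym (+-identityʳ i)) ni) (suc k′ * i + j)))
          where
          lemma : ∀ i K j → i + (K * i + j) ≡ i * suc K + j
          lemma = solve-∀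

        prev-blue : ∀ i → notR (y̅ (suc i)) → ∀ j → B (z̅ i) (y̅ j)
        prev-blue i ni j =
          subst (λ u → B u (y̅ j)) (trans (cong z̅ (lemma i k′)) (z-period i))
            (subst (B _) (trans (cong y̅ (lemma′ i k′ j)) (Y.multiple (suc i + k′ * j) j))
              (AlternatingFacts.z₀-blue (mirror (shift-alternating (suc i) a))
                (subst (notR ∘ y̅) (lemma″ i k′) ni) (suc i + suc k′ * j)))
          where
          lemma : ∀ i k′ → suc i + suc k′ * 1 ≡ suc (suc k′) + i
          lemma = solve-∀
          lemma′ : ∀ i k′ j → suc i + suc k′ * (suc i + suc k′ * j) ≡ (suc i + k′ * j) * suc (suc k′) + j
          lemma′ = solve-∀
          lemma″ : ∀ i k′ → suc i ≡ suc i + suc k′ * 0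
          lemma″ = solve-∀

        rest-of-range : ∀ (f : ℕ → V) i d e → suc k′ ≡ suc d + e →
          range f (suc i) d ++ f (suc d + i) ∷ range f (suc (suc d + i)) e ≡ range f (suc i) (suc k′)
        rest-of-range f i d e eq =
          trans (cong (λ j → range f (suc i) d ++ range f j (suc e)) (sym (+-suc d i)))
            (trans (sym (range-++ f d (suc e))) (cong (range f (suc i)) (trans (+-suc d e) (sym eq))))

        tour : ∀ i d e → suc k′ ≡ suc d + e → notR (y̅ (suc d + i)) →
          ∃[ T ] S ↭ z̅ i ∷ y̅ (suc d + i) ∷ T × Path B (z̅ (suc d + i)) (y̅ i) T
        tour i zero e eq nj = _ ,
          ↭-trans (without-z i) (prep _ (↭-trans (↭-reflexive (cong (λ n → range z̅ (suc i) n ++ range y̅ (suc i) (suc n)) eq))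
            (shift (y̅ (suc i)) (range z̅ (suc i) (suc e)) (range y̅ (2 + i) (suc e))))) ,
          castEnd (trans (cong y̅ (wrap-index i 0 e eq)) (y-period i)) (z→y (suc i) e)
        tour i (suc d) e eq nj = _ ,
          ↭-trans (without-z i) (prep _
            (↭-trans (↭-reflexive (cong₂ _++_ (sym (rest-of-range z̅ i (suc d) e eq)) (sym (split-range′ y̅ i (suc d) e eq))))
            (↭-trans (↭-reflexive (cong (λ ys → (range z̅ (suc i) (suc d) ++ z̅ j ∷ range z̅ (suc j) e) ++ ys ++ range y̅ (suc j) (suc e))
                (trans (cong (range y̅ (suc i)) (+-comm 1 (suc d))) (trans (range-++ y̅ (suc d) 1)
                  (cong (λ n → range y̅ (suc i) (suc d) ++ range y̅ n 1) (+-suc (suc d) i))))))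
              (solve 6 (λ a b c d e f → (a ⊕ b ⊕ c) ⊕ (d ⊕ e) ⊕ f ⊜ e ⊕ b ⊕ (a ⊕ d) ⊕ c ⊕ f) ↭-refl
                (range z̅ (suc i) (suc d)) (z̅ j ∷ []) (range z̅ (suc j) e)
                (range y̅ (suc i) (suc d)) (y̅ j ∷ []) (range y̅ (suc j) (suc e)))))) ,
          join [ z̅ j ] (next-blue j nj (suc i))
            (join (y→z (suc i) d)
              (subst (λ n → B (z̅ n) (y̅ (suc j))) (sym (+-suc d i)) (prev-blue (suc d + i) nj (suc j)))
              (castEnd (trans (cong y̅ (trans (+-suc e j) (wrap-index i (suc d) e eq))) (y-period i)) (y→y (suc j) e)))
          where j = suc (suc d) + i

        module AtMostOne {x₀ p₀ : V} (x₀-notR : ∀ {v} → B x₀ v → notR v)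
          (exchange : ∀ {c u v S′} → S ↭ c ∷ S′ → Path B u v S′ → B x₀ u → B x₀ v → isR c → B p₀ c)
          (exchanged : ∀ {c u v S′} → S ↭ c ∷ S′ → Path B u v (x₀ ∷ S′) → B p₀ c → B v c → R p₀ u) where

          open Exchange exchange exchanged

          exchange-pair : ∀ i d e → suc k′ ≡ suc d + e → B x₀ (y̅ i) → B x₀ (y̅ (suc d + i)) →
            B p₀ (z̅ i) × R p₀ (z̅ (suc d + i))
          exchange-pair i d e eq xi xj with tour i d e eq (x₀-notR xj)
          ... | T , σ , Q = exchange-tour σ Q (B-sym (next-blue i (x₀-notR xi) (suc d + i))) xi xj

          at-most-one : ∀ i d e → suc k′ ≡ suc d + e → B x₀ (y̅ i) → B x₀ (y̅ (suc d + i)) → ⊥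
          at-most-one i d e eq xi xj = exclusive (proj₂ (exchange-pair i d e eq xi xj))
            (proj₁ (exchange-pair (suc d + i) e d (trans eq (cong suc (+-comm d e))) xj
              (subst (B x₀) (sym (trans (cong y̅ (wrap-index i d e eq)) (y-period i))) xi)))

        module OnceX = AtMostOne {x} {p} inj₁ (λ σ Q xu xv c → X-end.exchange σ Q xu xv (proj₂ c)) X-end.exchanged
        module OnceY = AtMostOne {y} {p′} inj₂ (λ σ Q xu xv c → Y-end.exchange σ Q xu xv (proj₁ c)) Y-end.exchanged

        sole : ∀ d e → suc k′ ≡ suc d + e → B x (y̅ 0) → B y (y̅ 0) → isR (y̅ (suc d))
        sole d e eq x0 y0 with isR? (y̅ (suc d))
        ... | inj₁ r         = r
        ... | inj₂ (inj₁ xj) = ⊥-elim (OnceX.at-most-one 0 d e eq x0 (subst (B x ∘ y̅) (sym (+-identityʳ (suc d))) xj))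
        ... | inj₂ (inj₂ yj) = ⊥-elim (OnceY.at-most-one 0 d e eq y0 (subst (B y ∘ y̅) (sym (+-identityʳ (suc d))) yj))

        half-red : ∀ d e → suc k′ ≡ suc d + e → notR (y̅ 0) → R x (y̅ (suc d)) ⊎ R y (y̅ (suc d))
        half-red d e eq n0 with total x (y̅ (suc d)) | total y (y̅ (suc d))
        ... | inj₁ r  | _       = inj₁ r
        ... | inj₂ _  | inj₁ r  = inj₂ r
        half-red d e eq (inj₁ x0) | inj₂ xj | inj₂ _ =
          ⊥-elim (OnceX.at-most-one 0 d e eq x0 (subst (B x ∘ y̅) (sym (+-identityʳ (suc d))) xj))
        half-red d e eq (inj₂ y0) | inj₂ _ | inj₂ yj =
          ⊥-elim (OnceY.at-most-one 0 d e eq y0 (subst (B y ∘ y̅) (sym (+-identityʳ (suc d))) yj))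

        range-++₀ : ∀ (f : ℕ → V) a b → range f 0 (a + b) ≡ range f 0 a ++ range f a b
        range-++₀ f a b = trans (range-++ f a b) (cong (λ j → range f 0 a ++ range f j b) (+-identityʳ a))

        range-++₁ : ∀ (f : ℕ → V) a b → range f 1 (a + b) ≡ range f 1 a ++ range f (suc a) b
        range-++₁ f a b = trans (range-++ f a b) (cong (λ j → range f 1 a ++ range f j b) (+-comm a 1))

        last-blue : notR (y̅ 0) → ∀ j → B (z̅ (suc k′)) (y̅ j)
        last-blue n0 = prev-blue (suc k′) (subst notR (sym (trans (cong y̅ (sym (+-identityʳ k))) (y-period 0))) n0)

        y₀-middle-blue : notR (y̅ 0) → ∀ i e → suc k′ ≡ suc i + suc e → B (y̅ 0) (z̅ (suc i))
        y₀-middle-blue n0 i e eq = ¬R⇒B impossible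
          where
          J = suc i
          A⁺ = castEnd (cong y̅ (+-identityʳ J)) (z→y 0 i)
          B⁺ = castEnd (cong z̅ (trans (lemma e i) (sym eq))) (y→z (suc J) e)
            where
            lemma : ∀ e i → e + suc (suc i) ≡ suc i + suc e
            lemma = solve-∀
          Az = range z̅ 0 J
          Ay = range y̅ 1 J
          Bz = range z̅ (suc J) (suc e)
          By = range y̅ (suc J) (suc e)
          around-middle : Path B (z̅ 0) (y̅ (suc J)) ((Az ++ Ay) ++ Bz ++ By)
          around-middle = join A⁺ (B-sym (last-blue n0 J)) (reverse B-sym B⁺)
          pieces : S ↭ (Az ++ z̅ J ∷ Bz) ++ y̅ 0 ∷ Ay ++ By
          pieces = ↭-trans cover (↭-reflexive (cong₂ (λ zs ys → zs ++ y̅ 0 ∷ ys)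
            (trans (cong (range z̅ 0) (trans (cong suc eq) (sym (+-suc J (suc e))))) (range-++₀ z̅ J (2 + e)))
            (trans (cong (range y̅ 1) eq) (range-++₁ y̅ J (suc e)))))
          y₀-two-step : R (y̅ 0) (y̅ (suc J))
          y₀-two-step = skip
            (↭-trans pieces (solve 6 (λ a z b y c d → (a ⊕ z ⊕ b) ⊕ y ⊕ c ⊕ d ⊜ z ⊕ y ⊕ (a ⊕ c) ⊕ b ⊕ d) ↭-refl
              Az (z̅ J ∷ []) Bz (y̅ 0 ∷ []) Ay By))
            (z-isR J) (join [ y̅ 0 ] (yz 0) around-middle)
          remove-two : R (y̅ 0) (z̅ J) → R x (y̅ 0) ⊎ R y (y̅ 0) → ⊥
          remove-two r half = absorb-end
            (↭-trans pieces (solve 6 (λ a z b y c d → (a ⊕ z ⊕ b) ⊕ y ⊕ c ⊕ d ⊜ (z ⊕ y) ⊕ (a ⊕ c) ⊕ b ⊕ d) ↭-refl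
              Az (z̅ J ∷ []) Bz (y̅ 0 ∷ []) Ay By))
            (join [ z̅ J ] (R-sym r) [ y̅ 0 ]) (z-isR J) half
            (closed around-middle (B-sym (next-blue 0 n0 (suc J))))
          impossible : R (y̅ 0) (z̅ J) → ⊥
          -- If y̅ 0 is blue to both x and y, then all other vertices are in isR and the cycle can be cut at y̅ 0 and z̅ J.
          impossible r with total x (y̅ 0) | total y (y̅ 0)
          ... | inj₂ x0 | inj₂ y0 = absorb-end
            (↭-trans pieces (solve 6 (λ a z b y c d → (a ⊕ z ⊕ b) ⊕ y ⊕ c ⊕ d ⊜ ((z ⊕ b) ⊕ y ⊕ d) ⊕ a ⊕ c) ↭-refl
              Az (z̅ J ∷ []) Bz (y̅ 0 ∷ []) Ay By))
            (join (reverse R-sym (segment≤ z̅ J (suc e) λ t t≤e → z-two-step (t + J) (others (t + suc i) (from-bound t (s≤s⁻¹ t≤e)))))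
              (R-sym r) (join [ y̅ 0 ] y₀-two-step (y-segment (suc J) e)))
            (z-isR _) (inj₁ (proj₁ (subst (isR ∘ y̅) (sym (+-suc e (suc i))) (others (e + suc i) (from-bound e ≤-refl)))))
            (closed A⁺ (B-sym (next-blue 0 n0 J)))
            where
            others : ∀ d → ∃[ o ] suc k′ ≡ suc d + o → isR (y̅ (suc d))
            others d (o , eq) = sole d o eq x0 y0
            from-bound : ∀ t → t ≤ e → ∃[ o ] suc k′ ≡ suc (t + suc i) + o
            from-bound t t≤e with m≤n⇒∃[o]m+o≡n t≤e
            ... | o , refl = o , trans eq (lemma i t o)
              where
              lemma : ∀ i t o → suc i + suc (t + o) ≡ suc (t + suc i) + o
              lemma = solve-∀
          ... | inj₁ x0 | _       = remove-two r (inj₁ x0)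
          ... | inj₂ _  | inj₁ y0 = remove-two r (inj₂ y0)

        y₀-blue : notR (y̅ 0) → ∀ j → B (y̅ 0) (z̅ j)
        y₀-blue n0 = Z.everywhere {P = B (y̅ 0)} below
          where
          below : ∀ j → j < k → B (y̅ 0) (z̅ j)
          below zero _ = yz 0
          below (suc i) (s≤s i<) with m≤n⇒∃[o]m+o≡n i<
          ... | zero , eq  = B-sym (subst (λ n → B (z̅ n) (y̅ 0)) (trans (sym eq) (+-identityʳ (suc i))) (last-blue n0 0))
          ... | suc e , eq = y₀-middle-blue n0 i e (sym eq)

        remove-pair : ∀ {i l T} → notR (y̅ 0) → R x (y̅ l) ⊎ R y (y̅ l) → S ↭ (z̅ i ∷ y̅ l ∷ []) ++ T →
          Cycle B T → B (z̅ i) (y̅ l)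
        remove-pair {i} {l} n0 half σ C = ¬R⇒B λ r → absorb-end σ (join [ z̅ i ] r [ y̅ l ]) (z-isR i) half C

        ahead-blue : notR (y̅ 0) → ∀ i f g → suc k′ ≡ suc (f + suc (suc i)) + g →
          B (z̅ (suc i)) (y̅ (suc (f + suc (suc i))))
        ahead-blue n0 i f g eq = remove-pair n0 (half-red (f + suc J) g eq n0)
          (↭-trans cover (↭-trans (↭-reflexive (cong₂ (λ zs ys → zs ++ y̅ 0 ∷ ys) zs ys))
            (solve 9 (λ z₁ z z₂ z₃ y₀ y₁ y₂ y y₃ →
                (z₁ ⊕ z ⊕ z₂ ⊕ z₃) ⊕ y₀ ⊕ y₁ ⊕ y₂ ⊕ y ⊕ y₃ ⊜
                (z ⊕ y) ⊕ y₀ ⊕ (z₂ ⊕ y₂) ⊕ (z₁ ⊕ y₁) ⊕ z₃ ⊕ y₃) ↭-refl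
              (range z̅ 0 J) (z̅ J ∷ []) (range z̅ (suc J) (suc f)) (range z̅ l (suc g))
              (y̅ 0 ∷ []) (range y̅ 1 J) (range y̅ (suc J) (suc f)) (y̅ l ∷ []) (range y̅ (suc l) g))))
          (closed
            (join [ y̅ 0 ] (y₀-blue n0 (f + suc J))
              (join (reverse B-sym (y→z (suc J) f)) (B-sym (next-blue 0 n0 (suc J)))
                (join (castEnd (cong y̅ (+-identityʳ J)) (z→y 0 i)) (B-sym (last-blue n0 J))
                  (reverse B-sym (castEnd (cong z̅ (trans (+-comm g l) (sym eq))) (z→z l g))))))
            (B-sym (y₀-blue n0 l)))
          where
          J = suc i
          l = suc (f + suc J)
          zs : range z̅ 0 k ≡ range z̅ 0 J ++ z̅ J ∷ range z̅ (suc J) (suc f) ++ range z̅ l (suc g)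
          zs = trans (cong (range z̅ 0) (trans (cong suc eq) (lemma f J g)))
            (trans (range-++₀ z̅ J (suc (suc f + suc g)))
              (cong (λ r → range z̅ 0 J ++ z̅ J ∷ r) (range-++ z̅ (suc f) (suc g))))
            where
            lemma : ∀ f J g → suc (suc (f + suc J) + g) ≡ J + suc (suc f + suc g)
            lemma = solve-∀
          ys : range y̅ 1 (suc k′) ≡ range y̅ 1 J ++ range y̅ (suc J) (suc f) ++ y̅ l ∷ range y̅ (suc l) g
          ys = trans (cong (range y̅ 1) (trans eq (lemma f J g)))
            (trans (range-++₁ y̅ J (suc f + suc g))
              (cong (range y̅ 1 J ++_) (range-++ y̅ (suc f) (suc g))))
            where
            lemma : ∀ f J g → suc (f + suc J) + g ≡ J + (suc f + suc g)
            lemma = solve-∀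

        behind-blue : notR (y̅ 0) → ∀ l f e → suc k′ ≡ suc (f + suc l) + suc e →
          B (z̅ (suc (f + suc l))) (y̅ (suc l))
        behind-blue n0 l′ f e eq = remove-pair n0 (half-red l′ (suc f + suc e) (trans eq (lemma₀ f l′ e)) n0)
          (↭-trans cover (↭-trans (↭-reflexive (cong₂ (λ zs ys → zs ++ y̅ 0 ∷ ys) zs ys))
            (solve 9 (λ z₁ z₂ z z₃ y₀ y₁ y y₂ y₃ →
                (z₁ ⊕ z₂ ⊕ z ⊕ z₃) ⊕ y₀ ⊕ y₁ ⊕ y ⊕ y₂ ⊕ y₃ ⊜
                (z ⊕ y) ⊕ y₀ ⊕ (z₂ ⊕ y₂) ⊕ (z₃ ⊕ y₃) ⊕ z₁ ⊕ y₁) ↭-refl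
              (range z̅ 0 l) (range z̅ l (suc f)) (z̅ i ∷ []) (range z̅ (suc i) (suc e))
              (y̅ 0 ∷ []) (range y̅ 1 l′) (y̅ l ∷ []) (range y̅ (suc l) (suc f)) (range y̅ (suc i) (suc e)))))
          (closed
            (join [ y̅ 0 ] (y₀-blue n0 l)
              (join (z→y l f) (B-sym (last-blue n0 i))
                (join (reverse B-sym (castEnd (cong z̅ (trans (lemma₁ e i) (sym eq))) (y→z (suc i) e)))
                  (B-sym (next-blue 0 n0 (suc i)))
                  (castEnd (cong z̅ (+-identityʳ l′)) (z→z 0 l′)))))
            (B-sym (y₀-blue n0 l′)))
          where
          l = suc l′
          i = suc (f + l)
          lemma₀ : ∀ f l e → suc (f + suc l) + suc e ≡ suc l + (suc f + suc e)
          lemma₀ = solve-∀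
          lemma₁ : ∀ e i → e + suc i ≡ i + suc e
          lemma₁ = solve-∀
          zs : range z̅ 0 k ≡ range z̅ 0 l ++ range z̅ l (suc f) ++ z̅ i ∷ range z̅ (suc i) (suc e)
          zs = trans (cong (range z̅ 0) (trans (cong suc eq) (lemma f l e)))
            (trans (range-++₀ z̅ l (suc f + suc (suc e)))
              (cong (range z̅ 0 l ++_) (range-++ z̅ (suc f) (suc (suc e)))))
            where
            lemma : ∀ f l e → suc (suc (f + l) + suc e) ≡ l + (suc f + suc (suc e))
            lemma = solve-∀
          ys : range y̅ 1 (suc k′) ≡ range y̅ 1 l′ ++ y̅ l ∷ range y̅ (suc l) (suc f) ++ range y̅ (suc i) (suc e)
          ys = trans (cong (range y̅ 1) (trans eq (lemma f l′ e)))
            (trans (range-++₁ y̅ l′ (suc (suc f + suc e)))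
              (cong (λ r → range y̅ 1 l′ ++ y̅ l ∷ r)
                (trans (range-++ y̅ (suc f) (suc e)) (cong (λ n → range y̅ (suc l) (suc f) ++ range y̅ n (suc e)) (+-suc (suc f) l)))))
            where
            lemma : ∀ f l e → suc (f + suc l) + suc e ≡ l + suc (suc f + suc e)
            lemma = solve-∀

        all-blue-below : notR (y̅ 0) → ∀ i l → i < k → l < k → B (z̅ i) (y̅ l)
        all-blue-below n0 zero    l       _ _ = next-blue 0 n0 l
        all-blue-below n0 (suc i) zero    _ _ = B-sym (y₀-blue n0 (suc i))
        all-blue-below n0 (suc i) (suc l) (s≤s i<) (s≤s l<) with <-cmp i l
        ... | tri≈ _ refl _ = B-sym (yz (suc i))
        ... | tri< i<l _ _ with m≤n⇒∃[o]m+o≡n i<l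
        ...   | zero , refl = subst (λ n → B (z̅ (suc i)) (y̅ n)) (cong (suc ∘ suc) (sym (+-identityʳ i))) (zy (suc i))
        ...   | suc f , refl with m≤n⇒∃[o]m+o≡n l<
        ...     | g , eq = subst (λ n → B (z̅ (suc i)) (y̅ n)) (lemma f i)
          (ahead-blue n0 i f g (trans (sym eq) (cong (_+ g) (sym (lemma f i)))))
          where
          lemma : ∀ f i → suc (f + suc (suc i)) ≡ suc (suc i + suc f)
          lemma = solve-∀
        all-blue-below n0 (suc i) (suc l) (s≤s i<) (s≤s l<) | tri> _ _ l<i
          with m≤n⇒∃[o]m+o≡n l<i | m≤n⇒∃[o]m+o≡n i<
        ... | f , refl | zero , eq =
          subst (λ n → B (z̅ n) (y̅ (suc l))) (trans (sym eq) (+-identityʳ _)) (last-blue n0 (suc l))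
        ... | f , refl | suc e , eq = subst (λ n → B (z̅ n) (y̅ (suc l))) (lemma f l)
          (behind-blue n0 l f e (trans (sym eq) (cong (_+ suc e) (sym (lemma f l)))))
          where
          lemma : ∀ f l → suc (f + suc l) ≡ suc (suc l + f)
          lemma = solve-∀

        all-blue : notR (y̅ 0) ⊎ (∀ i → isR (y̅ i)) → ∀ i l → B (z̅ i) (y̅ l)
        all-blue (inj₁ n0) i l =
          Z.everywhere {P = λ u → B u (y̅ l)}
            (λ i i<k → Y.everywhere {P = B (z̅ i)} (λ l l<k → all-blue-below n0 i l i<k l<k) l) i
        all-blue (inj₂ r) i l = ¬R⇒B λ e → absorb-end
          (↭-trans (covers (suc i) l) (solve 1 (λ t → t ⊜ t ⊕ ∅) ↭-refl _))
          (join (castEnd (around z̅ z-period i) (segment z̅ (λ i → z-two-step i (r (suc i))) (suc i) (suc k′)))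
            e (y-segment l (suc k′)))
          (z-isR (suc i)) (inj₁ (proj₁ (r (suc k′ + l)))) none

      -- Completely joined halves

      module Complete {Z Y : List V} (S↭ : S ↭ Z ++ Y) (Z-isR : ∀ {z} → z ∈ Z → isR z)
        (blue : ∀ {z y} → z ∈ Z → y ∈ Y → B z y)
        (x-once : ∀ {u v T} → Y ↭ u ∷ v ∷ T → B x u → B x v → ⊥)
        (y-once : ∀ {u v T} → Y ↭ u ∷ v ∷ T → B y u → B y v → ⊥) where

        x-red : ∀ {u v T} → Y ↭ u ∷ v ∷ T → B x u → R x v
        x-red σ xu = ¬B⇒R (x-once σ xu)

        pick : ∀ {a b c T} → Y ↭ a ∷ b ∷ c ∷ T →
          ∃[ r ] ∃[ y′ ] ∃[ T′ ] Y ↭ r ∷ y′ ∷ T′ × isR r × R x y′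
        pick {a} {b} {c} {T} σ with isR? a | isR? b
        ... | inj₁ ra | _ with total x b
        ...   | inj₁ xb = a , b , c ∷ T , σ , ra , xb
        ...   | inj₂ xb = a , c , b ∷ T , ↭-trans σ (prep a (swap b c ↭-refl)) , ra ,
          x-red (↭-trans σ (solve 4 (λ a b c t → a ⊕ b ⊕ c ⊕ t ⊜ b ⊕ c ⊕ a ⊕ t) ↭-refl (a ∷ []) (b ∷ []) (c ∷ []) T)) xb
        pick {a} {b} {c} {T} σ | inj₂ na | inj₁ rb with total x a
        ...   | inj₁ xa = b , a , c ∷ T , ↭-trans σ (swap a b ↭-refl) , rb , xa
        ...   | inj₂ xa = b , c , a ∷ T ,
          ↭-trans σ (solve 4 (λ a b c t → a ⊕ b ⊕ c ⊕ t ⊜ b ⊕ c ⊕ a ⊕ t) ↭-refl (a ∷ []) (b ∷ []) (c ∷ []) T) , rb ,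
          x-red (↭-trans σ (prep a (swap b c ↭-refl))) xa
        pick σ | inj₂ (inj₁ xa) | inj₂ (inj₁ xb) = ⊥-elim (x-once σ xa xb)
        pick σ | inj₂ (inj₂ ya) | inj₂ (inj₂ yb) = ⊥-elim (y-once σ ya yb)
        pick {a} {b} {c} {T} σ | inj₂ (inj₁ xa) | inj₂ (inj₂ yb) = c , b , a ∷ T ,
          ↭-trans σ (solve 4 (λ a b c t → a ⊕ b ⊕ c ⊕ t ⊜ c ⊕ b ⊕ a ⊕ t) ↭-refl (a ∷ []) (b ∷ []) (c ∷ []) T) ,
          (x-red (↭-trans σ (prep a (swap b c ↭-refl))) xa ,
           ¬B⇒R (y-once (↭-trans σ (solve 4 (λ a b c t → a ⊕ b ⊕ c ⊕ t ⊜ b ⊕ c ⊕ a ⊕ t) ↭-refl (a ∷ []) (b ∷ []) (c ∷ []) T)) yb)) ,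
          x-red σ xa
        pick {a} {b} {c} {T} σ | inj₂ (inj₂ ya) | inj₂ (inj₁ xb) = c , a , b ∷ T ,
          ↭-trans σ (solve 4 (λ a b c t → a ⊕ b ⊕ c ⊕ t ⊜ c ⊕ a ⊕ b ⊕ t) ↭-refl (a ∷ []) (b ∷ []) (c ∷ []) T) ,
          (x-red (↭-trans σ (solve 4 (λ a b c t → a ⊕ b ⊕ c ⊕ t ⊜ b ⊕ c ⊕ a ⊕ t) ↭-refl (a ∷ []) (b ∷ []) (c ∷ []) T)) xb ,
           ¬B⇒R (y-once (↭-trans σ (prep a (swap b c ↭-refl))) ya)) ,
          x-red (↭-trans σ (swap a b ↭-refl)) xb

        zigzag : ∀ u Zs Ys → length Zs ≡ length Ys → (∀ {z y} → z ∈ u ∷ Zs → y ∈ Ys → B z y) →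
          ∃[ e ] Path B u e (u ∷ Zs ++ Ys) × e ∈ u ∷ Zs
        zigzag u []       []       _  _ = u , [ u ] , here refl
        zigzag u (z ∷ Zs) (y ∷ Ys) eq b with zigzag z Zs Ys (suc-injective eq) (λ z∈ y∈ → b (there z∈) (there y∈))
        ... | e , Q , e∈ = e ,
          reorder (solve 5 (λ u y z s t → u ⊕ y ⊕ z ⊕ s ⊕ t ⊜ u ⊕ (z ⊕ s) ⊕ y ⊕ t) ↭-refl
                    (u ∷ []) (y ∷ []) (z ∷ []) Zs Ys)
            (join [ u ] (b (here refl) (here refl)) (join [ y ] (B-sym (b (there (here refl)) (here refl))) Q)) ,
          there e∈

        balanced : ∀ u v Zs Ys → length Zs ≡ length Ys → (∀ {z y} → z ∈ u ∷ Zs → y ∈ v ∷ Ys → B z y) →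
          Cycle B ((u ∷ Zs) ++ v ∷ Ys)
        balanced u v Zs Ys eq b with zigzag u Zs Ys eq (λ z∈ y∈ → b z∈ (there y∈))
        ... | e , Q , e∈ = reorder
          (solve 4 (λ u v z y → (u ⊕ z ⊕ y) ⊕ v ⊜ (u ⊕ z) ⊕ v ⊕ y) ↭-refl (u ∷ []) (v ∷ []) Zs Ys)
          (closed (join Q (b e∈ (here refl)) [ v ]) (B-sym (b (here refl) (here refl))))

        balanced-with : ∀ t u v Zs Ys → length Zs ≡ length Ys → (∀ {z y} → z ∈ u ∷ Zs → y ∈ v ∷ Ys → B z y) →
          B t u → B t v → Cycle B (t ∷ (u ∷ Zs) ++ v ∷ Ys)
        balanced-with t u v Zs Ys eq b tu tv with zigzag u Zs Ys eq (λ z∈ y∈ → b z∈ (there y∈))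
        ... | e , Q , e∈ = reorder
          (solve 5 (λ t u v z y → (u ⊕ z ⊕ y) ⊕ v ⊕ t ⊜ t ⊕ (u ⊕ z) ⊕ v ⊕ y) ↭-refl (t ∷ []) (u ∷ []) (v ∷ []) Zs Ys)
          (closed (join Q (b e∈ (here refl)) (join [ v ] (B-sym tv) [ t ])) tu)

        -- q is the neighbour of p on the path, other than x.
        module Large {q T} (pq : R p q) (Q : Path R q y T) (τ : I ++ y ∷ [] ↭ p ∷ T)
          {e z r y′ Zs Ys} (Z↭ : Z ↭ e ∷ z ∷ Zs) (Y↭ : Y ↭ r ∷ y′ ∷ Ys) (eq : length Zs ≡ length Ys)
          (r-isR : isR r) (xy′ : R x y′) where

          whole↭ : (x ∷ p ∷ T) ++ (e ∷ z ∷ Zs) ++ r ∷ y′ ∷ Ys ↭ X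
          whole↭ = ↭-trans (++⁺ (prep x (↭-trans (↭-sym τ) (++-comm I (y ∷ [])))) (↭-trans (++⁺ (↭-sym Z↭) (↭-sym Y↭)) (↭-sym S↭))) part

          e∈ : e ∈ Z
          e∈ = ∈-resp-↭ (↭-sym Z↭) (here refl)
          z∈ : z ∈ Z
          z∈ = ∈-resp-↭ (↭-sym Z↭) (there (here refl))
          r∈ : r ∈ Y
          r∈ = ∈-resp-↭ (↭-sym Y↭) (here refl)
          y′∈ : y′ ∈ Y
          y′∈ = ∈-resp-↭ (↭-sym Y↭) (there (here refl))
          Zs⊆ : ∀ {u} → u ∈ Zs → u ∈ Z
          Zs⊆ u∈ = ∈-resp-↭ (↭-sym Z↭) (there (there u∈))
          Ys⊆ : ∀ {u} → u ∈ Ys → u ∈ Y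
          Ys⊆ u∈ = ∈-resp-↭ (↭-sym Y↭) (there (there u∈))
          cons⊆ : ∀ {u : V} {A A′} → u ∈ A → (∀ {v} → v ∈ A′ → v ∈ A) → ∀ {v} → v ∈ u ∷ A′ → v ∈ A
          cons⊆ u∈ f (here refl) = u∈
          cons⊆ u∈ f (there v∈)  = f v∈

          detour : ∀ {t c g A C} → Path R t y A → isR c → R x g → Cycle B C → (A ++ c ∷ x ∷ g ∷ []) ++ C ↭ X → B t g
          detour {g = g} W (xc , yc) xg C σ = ¬R⇒B λ tg →
            no-cycles (closed (join W yc (join [ _ ] (R-sym xc) (join [ x ] xg [ g ]))) (R-sym tg)) C σ

          from-p : Path R p y (p ∷ T)
          from-p = join [ p ] pq Q

          p-z : B p z
          p-z = detour from-p r-isR (proj₁ (Z-isR z∈))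
            (balanced e y′ Zs Ys eq λ a b → blue (cons⊆ e∈ Zs⊆ a) (cons⊆ y′∈ Ys⊆ b))
            (↭-trans (solve 9 (λ x p t e z zs r y ys → ((p ⊕ t) ⊕ r ⊕ x ⊕ z) ⊕ (e ⊕ zs) ⊕ y ⊕ ys ⊜ (x ⊕ p ⊕ t) ⊕ (e ⊕ z ⊕ zs) ⊕ r ⊕ y ⊕ ys) ↭-refl
              (x ∷ []) (p ∷ []) T (e ∷ []) (z ∷ []) Zs (r ∷ []) (y′ ∷ []) Ys) whole↭)

          p-e : B p e
          p-e = detour from-p r-isR (proj₁ (Z-isR e∈))
            (balanced z y′ Zs Ys eq λ a b → blue (cons⊆ z∈ Zs⊆ a) (cons⊆ y′∈ Ys⊆ b))
            (↭-trans (solve 9 (λ x p t e z zs r y ys → ((p ⊕ t) ⊕ r ⊕ x ⊕ e) ⊕ (z ⊕ zs) ⊕ y ⊕ ys ⊜ (x ⊕ p ⊕ t) ⊕ (e ⊕ z ⊕ zs) ⊕ r ⊕ y ⊕ ys) ↭-refl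
              (x ∷ []) (p ∷ []) T (e ∷ []) (z ∷ []) Zs (r ∷ []) (y′ ∷ []) Ys) whole↭)

          p-y′ : B p y′
          p-y′ = detour from-p (Z-isR z∈) xy′
            (balanced e r Zs Ys eq λ a b → blue (cons⊆ e∈ Zs⊆ a) (cons⊆ r∈ Ys⊆ b))
            (↭-trans (solve 9 (λ x p t e z zs r y ys → ((p ⊕ t) ⊕ z ⊕ x ⊕ y) ⊕ (e ⊕ zs) ⊕ r ⊕ ys ⊜ (x ⊕ p ⊕ t) ⊕ (e ⊕ z ⊕ zs) ⊕ r ⊕ y ⊕ ys) ↭-refl
              (x ∷ []) (p ∷ []) T (e ∷ []) (z ∷ []) Zs (r ∷ []) (y′ ∷ []) Ys) whole↭)

          p-r : B p r
          p-r = detour from-p (Z-isR z∈) (proj₁ r-isR)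
            (balanced e y′ Zs Ys eq λ a b → blue (cons⊆ e∈ Zs⊆ a) (cons⊆ y′∈ Ys⊆ b))
            (↭-trans (solve 9 (λ x p t e z zs r y ys → ((p ⊕ t) ⊕ z ⊕ x ⊕ r) ⊕ (e ⊕ zs) ⊕ y ⊕ ys ⊜ (x ⊕ p ⊕ t) ⊕ (e ⊕ z ⊕ zs) ⊕ r ⊕ y ⊕ ys) ↭-refl
              (x ∷ []) (p ∷ []) T (e ∷ []) (z ∷ []) Zs (r ∷ []) (y′ ∷ []) Ys) whole↭)

          q-r : B q r
          q-r = detour Q (Z-isR e∈) (proj₁ r-isR)
            (balanced-with p z y′ Zs Ys eq (λ a b → blue (cons⊆ z∈ Zs⊆ a) (cons⊆ y′∈ Ys⊆ b)) p-z p-y′)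
            (↭-trans (solve 9 (λ x p t e z zs r y ys → (t ⊕ e ⊕ x ⊕ r) ⊕ p ⊕ (z ⊕ zs) ⊕ y ⊕ ys ⊜ (x ⊕ p ⊕ t) ⊕ (e ⊕ z ⊕ zs) ⊕ r ⊕ y ⊕ ys) ↭-refl
              (x ∷ []) (p ∷ []) T (e ∷ []) (z ∷ []) Zs (r ∷ []) (y′ ∷ []) Ys) whole↭)

          q-z : B q z
          q-z = detour Q r-isR (proj₁ (Z-isR z∈))
            (balanced-with p e y′ Zs Ys eq (λ a b → blue (cons⊆ e∈ Zs⊆ a) (cons⊆ y′∈ Ys⊆ b)) p-e p-y′)
            (↭-trans (solve 9 (λ x p t e z zs r y ys → (t ⊕ r ⊕ x ⊕ z) ⊕ p ⊕ (e ⊕ zs) ⊕ y ⊕ ys ⊜ (x ⊕ p ⊕ t) ⊕ (e ⊕ z ⊕ zs) ⊕ r ⊕ y ⊕ ys) ↭-refl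
              (x ∷ []) (p ∷ []) T (e ∷ []) (z ∷ []) Zs (r ∷ []) (y′ ∷ []) Ys) whole↭)

          impossible : ⊥
          impossible with uncons Q
          ... | only refl _ = exclusive (proj₂ (Z-isR z∈)) q-z
          ... | more {T = T₃} _ Q₃ τ₃ with zigzag z Zs Ys eq (λ a b → blue (cons⊆ z∈ Zs⊆ a) (Ys⊆ b))
          ...   | f , W , f∈ = no-shorter-R
            (some (join Q₃ (proj₂ (Z-isR e∈)) (join [ e ] (R-sym (proj₁ (Z-isR e∈))) [ x ])))
            (subst (length (T₃ ++ e ∷ x ∷ []) <_) len
              (≤-reflexive (trans (cong suc (trans (↭-length (++-comm T₃ (e ∷ x ∷ []))) (cong suc (sym (↭-length τ₃)))))
                (cong suc (trans (sym (↭-length τ)) (↭-length (++-comm I (y ∷ [])))))))) 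
            (closed (join [ q ] q-z (join W (blue (cons⊆ z∈ Zs⊆ f∈) y′∈) (join [ y′ ] (B-sym p-y′) (join [ p ] p-r [ r ])))) (B-sym q-r))
            (↭-trans (solve 10 (λ x p q t e z zs r y ys → (t ⊕ e ⊕ x) ⊕ q ⊕ (z ⊕ zs ⊕ ys) ⊕ y ⊕ p ⊕ r ⊜ (x ⊕ p ⊕ q ⊕ t) ⊕ (e ⊕ z ⊕ zs) ⊕ r ⊕ y ⊕ ys) ↭-refl
              (x ∷ []) (p ∷ []) (q ∷ []) T₃ (e ∷ []) (z ∷ []) Zs (r ∷ []) (y′ ∷ []) Ys)
              (↭-trans (prep x (prep p (++⁺ʳ _ (↭-sym τ₃)))) whole↭))

        module Small {z z′ u v} (Z↭ : Z ↭ z ∷ z′ ∷ []) (Y↭ : Y ↭ u ∷ v ∷ []) where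

          S↭₄ : S ↭ z ∷ z′ ∷ u ∷ v ∷ []
          S↭₄ = ↭-trans S↭ (++⁺ Z↭ Y↭)

          z∈ : z ∈ Z
          z∈ = ∈-resp-↭ (↭-sym Z↭) (here refl)
          z′∈ : z′ ∈ Z
          z′∈ = ∈-resp-↭ (↭-sym Z↭) (there (here refl))
          u∈ : u ∈ Y
          u∈ = ∈-resp-↭ (↭-sym Y↭) (here refl)
          v∈ : v ∈ Y
          v∈ = ∈-resp-↭ (↭-sym Y↭) (there (here refl))

          I-single : I ↭ p ∷ []
          I-single with dropStart P
          ... | [] , _ , τ = τ
          ... | w ∷ ws , _ , τ = ⊥-elim (no-shorter-B
            (some (join [ u ] (B-sym (blue z′∈ u∈)) (join [ z′ ] (blue z′∈ v∈) [ v ])))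
            (subst (3 <_) len (s≤s (s≤s (≤-trans (s≤s (s≤s z≤n)) (≤-reflexive (sym (↭-length τ)))))))
            (closed (join whole (proj₂ (Z-isR z∈)) [ z ]) (R-sym (proj₁ (Z-isR z∈))))
            (↭-trans (solve 7 (λ x y i z z′ u v → (u ⊕ z′ ⊕ v) ⊕ (x ⊕ i ⊕ y) ⊕ z ⊜ (x ⊕ y ⊕ i) ⊕ z ⊕ z′ ⊕ u ⊕ v) ↭-refl
                (x ∷ []) (y ∷ []) I (z ∷ []) (z′ ∷ []) (u ∷ []) (v ∷ []))
              (↭-trans (++⁺ˡ (x ∷ y ∷ I) (↭-sym S↭₄)) part)))

          whole↭ : x ∷ y ∷ p ∷ z ∷ z′ ∷ u ∷ v ∷ [] ↭ X
          whole↭ = ↭-trans (prep x (prep y (++⁺ (↭-sym I-single) (↭-sym S↭₄)))) part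

          one-isR : isR u → ⊥
          one-isR r = no-cycles
            (closed (join [ x ] (proj₁ (Z-isR z∈)) (join [ z ] zz′
              (join [ z′ ] (R-sym (proj₂ (Z-isR z′∈))) (join [ y ] (proj₂ r) [ u ])))) (R-sym (proj₁ r)))
            (pair p v)
            (↭-trans (solve 7 (λ x y p z z′ u v → (x ⊕ z ⊕ z′ ⊕ y ⊕ u) ⊕ p ⊕ v ⊜ x ⊕ y ⊕ p ⊕ z ⊕ z′ ⊕ u ⊕ v) ↭-refl
                (x ∷ []) (y ∷ []) (p ∷ []) (z ∷ []) (z′ ∷ []) (u ∷ []) (v ∷ [])) whole↭)
            where
            zz′ : R z z′
            zz′ = skip (↭-trans S↭₄ (solve 4 (λ z z′ u v → z ⊕ z′ ⊕ u ⊕ v ⊜ u ⊕ z ⊕ v ⊕ z′) ↭-refl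
                    (z ∷ []) (z′ ∷ []) (u ∷ []) (v ∷ [])))
                  r (join [ z ] (blue z∈ v∈) (join [ v ] (B-sym (blue z′∈ v∈)) [ z′ ]))

          one-each : B x u → B y v → ⊥
          one-each xu yv = no-cycles (pair p z′)
            (closed (join [ z ] (blue z∈ u∈) (join [ u ] (B-sym xu) (join [ x ] xy (join [ y ] yv [ v ])))) (B-sym (blue z∈ v∈)))
            (↭-trans (solve 7 (λ x y p z z′ u v → (p ⊕ z′) ⊕ z ⊕ u ⊕ x ⊕ y ⊕ v ⊜ x ⊕ y ⊕ p ⊕ z ⊕ z′ ⊕ u ⊕ v) ↭-refl
                (x ∷ []) (y ∷ []) (p ∷ []) (z ∷ []) (z′ ∷ []) (u ∷ []) (v ∷ [])) whole↭)

        small : ∀ {z z′ u v} → Z ↭ z ∷ z′ ∷ [] → Y ↭ u ∷ v ∷ [] → ⊥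
        small {z} {z′} {u} {v} σ τ with isR? u | isR? v
        ... | inj₁ r | _                       = Small.one-isR σ τ r
        ... | inj₂ _ | inj₁ r                  = Small.one-isR σ (↭-trans τ (swap u v ↭-refl)) r
        ... | inj₂ (inj₁ xu) | inj₂ (inj₁ xv)  = x-once τ xu xv
        ... | inj₂ (inj₂ yu) | inj₂ (inj₂ yv)  = y-once τ yu yv
        ... | inj₂ (inj₁ xu) | inj₂ (inj₂ yv)  = Small.one-each σ τ xu yv
        ... | inj₂ (inj₂ yu) | inj₂ (inj₁ xv)  = Small.one-each σ (↭-trans τ (swap u v ↭-refl)) xv yu

        large : ∀ {e z a b c Zs Ys} → Z ↭ e ∷ z ∷ Zs → Y ↭ a ∷ b ∷ c ∷ Ys → length Zs ≡ suc (length Ys) → ⊥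
        large Z↭ Y↭ eq with pick Y↭ | uncons (join P p′y [ y ])
        ... | _ | only refl τ = absurd τ
          where
          absurd : I ++ p ∷ [] ↭ p ∷ [] → ⊥
          absurd τ with dropStart P
          ... | _ , _ , σ with () ← trans (sym (↭-length (↭-trans (↭-sym (++-comm I (p ∷ []))) τ))) (cong suc (↭-length σ))
        ... | r , y′ , Ys′ , τ , r-isR , xy′ | more pq Q σ =
          Large.impossible pq Q σ Z↭ τ
            (trans eq (suc-injective (suc-injective (trans (sym (↭-length Y↭)) (↭-length τ))))) r-isR xy′

      module NoAlternating {k′} (a : Alternating (2 + k′))
        (q : notR (Alternating.y̅ a 0) ⊎ (∀ i → isR (Alternating.y̅ a i))) where
        open AlternatingFacts a
        open AlternatingBlue a

        blue : ∀ {z y} → z ∈ range z̅ 0 k → y ∈ range y̅ 0 k → B z y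
        blue z∈ y∈ with range-index z∈ | range-index y∈
        ... | i , _ , refl | j , _ , refl = all-blue q i j

        all-isR : ∀ {z} → z ∈ range z̅ 0 k → isR z
        all-isR z∈ with range-index z∈
        ... | i , _ , refl = z-isR i

        once : ∀ {W : V → Set} → (∀ i d e → suc k′ ≡ suc d + e → W (y̅ i) → W (y̅ (suc d + i)) → ⊥) →
          ∀ {u v T} → range y̅ 0 k ↭ u ∷ v ∷ T → W u → W v → ⊥
        once {W} at-most-one {u} {v} {T} σ =
          labelled-clique {R = λ u v → W u → W v → ⊥} (λ f a b → f b a) {W = λ _ → ⊤}
            (λ i d e eq _ _ → at-most-one i d e eq) (label (here refl)) (label (there (here refl)))
            (unique-++⇒≢ (u ∷ []) (unique-↭ σ y-unique) (here refl) (here refl))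
          where
          y-unique : Unique (range y̅ 0 k)
          y-unique = unique-++ˡ (range y̅ 0 k) (unique-↭ (↭-trans cover (++-comm (range z̅ 0 k) _)) S-unique)
          label : ∀ {u′} → u′ ∈ u ∷ v ∷ T → Labelled (λ _ → ⊤) y̅ (suc k′) u′
          label u∈ with range-index (∈-resp-↭ (↭-sym σ) u∈)
          ... | i , i< , refl = i , subst (i <_) (+-identityʳ k) i< , _ , refl

        open Complete cover all-isR blue
          (once {B x} OnceX.at-most-one) (once {B y} OnceY.at-most-one) public

      no-alternating : ∀ {k′} (a : Alternating (2 + k′)) →
        notR (Alternating.y̅ a 0) ⊎ (∀ i → isR (Alternating.y̅ a i)) → ⊥
      no-alternating {zero}  a q = NoAlternating.small a q ↭-refl ↭-refl
      no-alternating {suc n} a q = NoAlternating.large a q ↭-refl ↭-refl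
        (cong suc (trans (range-length (Alternating.z̅ a) 3 n) (sym (range-length (Alternating.y̅ a) 3 n))))

      open Circuits {R = R} {B} R-sym B-sym total S-unique isR notR isR? ham-end-isR skip
        (λ Q ur vr → absorb (solve 1 (λ s → s ⊜ s ⊕ ∅) ↭-refl S) Q (proj₁ ur) (proj₂ vr) none)

      outcome⇒⊥ : ∀ {n} → Outcome (4 + n) → ⊥
      outcome⇒⊥ {n} (alternating (suc (suc k)) eq w odd q) = no-alternating
        record
          { y̅ = at ∘ double
          ; z̅ = at ∘ suc ∘ double
          ; y-period = λ i → trans (cong at (shifted i)) (period (double i))
          ; z-period = λ i → trans (cong at (trans (cong suc (shifted i)) (sym (+-suc (4 + n) (double i))))) (period (suc (double i)))
          ; yz = λ i → step (double i)
          ; zy = λ i → step (suc (double i))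
          ; z-isR = odd
          ; cover = ↭-trans cover (↭-trans (↭-reflexive (cong (range at 0) eq))
              (↭-trans (↭-sym (interleave at 0 (2 + k))) (++-comm (range (at ∘ double) 0 (2 + k)) _)))
          }
        (Sum.map₂ (λ r i → r (double i)) q)
        where
        open Circuit w
        shifted : ∀ i → double (2 + k + i) ≡ 4 + n + double i
        shifted i = trans (double-+ (2 + k) i) (cong (_+ double i) (sym eq))

      small-cycle : ∀ {S′} → length S′ ≤ 2 → Cycle B S′
      small-cycle {[]}            _ = none
      small-cycle {v ∷ []}        _ = single v
      small-cycle {u ∷ v ∷ []}    _ = pair u v
      small-cycle {_ ∷ _ ∷ _ ∷ _} (s≤s (s≤s ()))

      path-end-isR : ∀ {u v} → Path B u v S → ∃[ r ] ∃[ S′ ] S ↭ r ∷ S′ × isR r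
      path-end-isR {u} {v} Q with isR? u | isR? v
      ... | inj₁ ur | _       = let S′ , _ , σ = dropStart Q in u , S′ , σ , ur
      ... | inj₂ _  | inj₁ vr = let S′ , _ , σ = dropEnd B-sym Q in v , S′ , σ , vr
      ... | inj₂ nu | inj₂ nv = ⊥-elim (ham-end-isR Q nu nv)

      short-path⇒⊥ : ∀ {u v} → Path B u v S → length S ≤ 3 → ⊥
      short-path⇒⊥ Q short with path-end-isR Q
      ... | r , S′ , σ , r-isR = absorb-one σ r-isR (small-cycle (s≤s⁻¹ (subst (_≤ 3) (↭-length σ) short)))

      closed⇒⊥ : ∀ {u v} → Path B u v S → B v u → ⊥
      closed⇒⊥ Q vu = by-length (length S) refl
        where
        by-length : ∀ n → length S ≡ n → ⊥
        by-length (suc (suc (suc (suc n)))) eq = outcome⇒⊥ (classify (subst Circuit eq (closed⇒circuit Q vu)))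
        by-length 0 eq = short-path⇒⊥ Q (≤-trans (≤-reflexive eq) z≤n)
        by-length 1 eq = short-path⇒⊥ Q (≤-trans (≤-reflexive eq) (s≤s z≤n))
        by-length 2 eq = short-path⇒⊥ Q (≤-trans (≤-reflexive eq) (s≤s (s≤s z≤n)))
        by-length 3 eq = short-path⇒⊥ Q (≤-reflexive eq)

    path-ring⇒⊥ : Unique X → ∀ {T S} → MaybePath R T → length T ≡ m → Ring B S → T ++ S ↭ X → ⊥
    path-ring⇒⊥ X-unique none _ C part = no-cycles none (ring⇒cycle C) part
    path-ring⇒⊥ X-unique (some {x} {y} P₀) len C part with uncons P₀
    ... | only _ τ = no-cycles (reorder (↭-sym τ) (single x)) (ring⇒cycle C) part
    ... | more {p} {T₁} xp P₁ τ with uncons (reverse R-sym P₁)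
    ...   | only refl τ₁ = no-cycles (reorder (↭-sym (↭-trans τ (prep x τ₁))) (pair x y)) (ring⇒cycle C) part
    ...   | more {p′} {I} yp′ P₂ τ₁ with total y x
    ...     | inj₁ yx = no-cycles (closed P₀ yx) (ring⇒cycle C) part
    ...     | inj₂ yx = by-ring C part
      where
      σ : _ ↭ x ∷ y ∷ I
      σ = ↭-trans τ (prep x τ₁)
      len′ : 2 + length I ≡ m
      len′ = trans (sym (↭-length σ)) len
      S-unique : ∀ {S} → _ ++ S ↭ X → Unique S
      S-unique {S} part = unique-++ˡ S (unique-↭ (↭-trans (↭-sym part) (++-comm _ S)) X-unique)
      by-ring : ∀ {S} → Ring B S → _ ++ S ↭ X → ⊥
      by-ring none part = no-shorter-R (some P₂) (≤-trans (n≤1+n _) (≤-reflexive len′))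
        (closed (join [ x ] (B-sym yx) [ y ]) yx)
        (↭-trans (++-comm I (x ∷ y ∷ []))
          (↭-trans (↭-sym σ) (↭-trans (solve 1 (λ t → t ⊜ t ⊕ ∅) ↭-refl _) part)))
      by-ring (single v) part = Pair.short-path⇒⊥ xp (reverse R-sym P₂) (R-sym yp′) (B-sym yx) len′
        (↭-trans (++⁺ʳ _ (↭-sym σ)) part) (S-unique part) [ v ] (s≤s z≤n)
      by-ring {S} (closed Q e) part = Pair.closed⇒⊥ xp (reverse R-sym P₂) (R-sym yp′) (B-sym yx) len′
        (↭-trans (++⁺ʳ S (↭-sym σ)) part) (S-unique part) Q e

module _ {V : Set} {R B : V → V → Set}
  (R-sym : ∀ {u v} → R u v → R v u) (B-sym : ∀ {u v} → B u v → B v u)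
  (total : ∀ u v → R u v ⊎ B u v) (exclusive : ∀ {u v} → R u v → B u v → ⊥)
  {X : List V} (X-unique : Unique X)
  (no-cycles : ∀ {S T} → Cycle R S → Cycle B T → S ++ T ↭ X → ⊥) where

  no-path-ring : ∀ n →
    (∀ {S T} → MaybePath R S → length S < n → Ring B T → S ++ T ↭ X → ⊥) ×
    (∀ {S T} → MaybePath B S → length S < n → Ring R T → S ++ T ↭ X → ⊥)
  no-path-ring zero    = (λ _ ()) , (λ _ ())
  no-path-ring (suc n) with no-path-ring n
  ... | shorter-R , shorter-B =
    (λ p <n → Colouring.path-ring⇒⊥ R-sym B-sym total exclusive X no-cycles _
      (λ q <m → shorter-R q (≤-trans <m (s≤s⁻¹ <n))) (λ q <m → shorter-B q (≤-trans <m (s≤s⁻¹ <n)))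
      X-unique p refl) ,
    (λ p <n → Colouring.path-ring⇒⊥ B-sym R-sym (λ u v → Sum.swap (total u v)) (λ b r → exclusive r b) X
      (λ {S} {T} c d σ → no-cycles d c (↭-trans (++-comm T S) σ)) _
      (λ q <m → shorter-B q (≤-trans <m (s≤s⁻¹ <n))) (λ q <m → shorter-R q (≤-trans <m (s≤s⁻¹ <n)))
      X-unique p refl)

  two-colour-contradiction : ⊥
  two-colour-contradiction with two-paths R-sym B-sym X-unique (λ {u} {v} _ _ _ → total u v)
  ... | S , T , p , q , σ with paths⇒path-ring R-sym B-sym total p q σ
  ...   | inj₁ (S′ , T′ , p′ , c , σ′) = proj₁ (no-path-ring (suc (length S′))) p′ ≤-refl c σ′
  ...   | inj₂ (S′ , T′ , p′ , c , σ′) = proj₂ (no-path-ring (suc (length S′))) p′ ≤-refl c σ′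

-- Three completely joined classes

module _ {V : Set} where

  Complete : (V → V → Set) → List V → List V → Set
  Complete E X Y = ∀ {u v} → u ∈ X → v ∈ Y → E u v

  Flex : (V → V → Set) → List V → ℕ → Set
  Flex E X k = ∀ {Y} → k ≤ length Y → length Y ≤ length X → Complete E X Y → Cycle E (X ++ Y)

  module _ {E : V → V → Set} (E-sym : ∀ {u v} → E u v → E v u) where

    weave-path : ∀ {u v T} y Y → Path E u v T → length (y ∷ Y) ≤ length T → Complete E T (y ∷ Y) →
      ∃[ s ] ∃[ t ] Path E s t (T ++ y ∷ Y) × s ∈ T × t ∈ y ∷ Y
    weave-path y [] P _ E-TY = _ , y , join P (E-TY (end∈ P) (here refl)) [ y ] , start∈ P , here refl
    weave-path {u} {T = T} y (y′ ∷ Y) P Y≤T E-TY with uncons P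
    ... | only _ τ with s≤s () ← ≤-trans Y≤T (≤-reflexive (↭-length τ))
    ... | more {T = T′} _ P′ τ
      with weave-path y′ Y P′ (s≤s⁻¹ (≤-trans Y≤T (≤-reflexive (↭-length τ))))
             (λ a b → E-TY (∈-resp-↭ (↭-sym τ) (there a)) (there b))
    ...   | s , t , Q , s∈ , t∈ = u , t ,
      reorder (↭-trans (solve 4 (λ u t y ys → u ⊕ y ⊕ t ⊕ ys ⊜ (u ⊕ t) ⊕ y ⊕ ys) ↭-refl (u ∷ []) T′ (y ∷ []) (y′ ∷ Y))
                (++⁺ʳ (y ∷ y′ ∷ Y) (↭-sym τ)))
        (join [ u ] (E-TY (start∈ P) (here refl))
          (join [ y ] (E-sym (E-TY (∈-resp-↭ (↭-sym τ) (there s∈)) (here refl))) Q)) ,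
      start∈ P , there t∈

    weave : ∀ {u v T} U Y → Path E u v T → length U < length Y → length Y ≤ length U + length T →
      Complete E (U ++ T) Y → ∃[ s ] ∃[ t ] Path E s t ((U ++ T) ++ Y) × s ∈ U ++ T × t ∈ Y
    weave []      (y ∷ Y) P U<Y Y≤ E-TY = weave-path y Y P Y≤ E-TY
    weave {T = T} (a ∷ U) (y ∷ Y) P U<Y Y≤ E-TY
      with weave U Y P (s≤s⁻¹ U<Y) (s≤s⁻¹ Y≤) (λ a b → E-TY (there a) (there b))
    ... | s , t , Q , s∈ , t∈ = a , t ,
      reorder (solve 4 (λ a u y ys → a ⊕ y ⊕ u ⊕ ys ⊜ (a ⊕ u) ⊕ y ⊕ ys) ↭-refl (a ∷ []) (U ++ T) (y ∷ []) Y)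
        (join [ a ] (E-TY (here refl) (here refl)) (join [ y ] (E-sym (E-TY (there s∈) (here refl))) Q)) ,
      here refl , there t∈

    weave-cycle : ∀ {u v T X} U {Y} → Path E u v T → X ↭ U ++ T → length U < length Y → length Y ≤ length X →
      Complete E X Y → Cycle E (X ++ Y)
    weave-cycle {T = T} U {Y} P σ U<Y Y≤X E-XY
      with weave U Y P U<Y (≤-trans Y≤X (≤-reflexive (trans (↭-length σ) (length-++ U))))
             (λ a b → E-XY (∈-resp-↭ (↭-sym σ) a) b)
    ... | s , t , Q , s∈ , t∈ =
      reorder (++⁺ʳ Y (↭-sym σ)) (closed Q (E-sym (E-XY (∈-resp-↭ (↭-sym σ) s∈) t∈)))

    flex-path : ∀ {u v T X} U → Path E u v T → X ↭ U ++ T → Flex E X (suc (length U))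
    flex-path U P σ = weave-cycle U P σ

    flex-closed : ∀ {u v X} → Path E u v X → E v u → Flex E X 0
    flex-closed {X = X} P e {[]}    _ _   _    = reorder (solve 1 (λ x → x ⊜ x ⊕ ∅) ↭-refl X) (closed P e)
    flex-closed P e         {_ ∷ _} _ Y≤X E-XY = weave-cycle [] P ↭-refl (s≤s z≤n) Y≤X E-XY

    flex-single : ∀ v {X} → X ↭ v ∷ [] → Flex E X 0
    flex-single v σ {[]}        _ _   _ = reorder (↭-trans (↭-sym σ) (solve 1 (λ x → x ⊜ x ⊕ ∅) ↭-refl _)) (single v)
    flex-single v σ {y ∷ []}    _ _   _ = reorder (++⁺ʳ (y ∷ []) (↭-sym σ)) (pair v y)
    flex-single v σ {_ ∷ _ ∷ _} _ Y≤X _ with s≤s () ← ≤-trans Y≤X (≤-reflexive (↭-length σ))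

  flex-reorder : ∀ {E : V → V → Set} {X X′ k} → X ↭ X′ → Flex E X k → Flex E X′ k
  flex-reorder σ f {Y} k≤ ≤X E-XY = reorder (++⁺ʳ Y σ)
    (f k≤ (≤-trans ≤X (≤-reflexive (sym (↭-length σ)))) (λ a b → E-XY (∈-resp-↭ σ a) b))

  TwoFlex : (A B : V → V → Set) → List V → Set
  TwoFlex A B X = ∃[ i ] ∃[ j ] i + j ≤ length X × Flex A X i × Flex B X j

  swap-flex : ∀ {A B X} → TwoFlex A B X → TwoFlex B A X
  swap-flex {X = X} (i , j , i+j≤ , f , g) = j , i , subst (_≤ length X) (+-comm i j) i+j≤ , g , f

  module _ {A B : V → V → Set} (A-sym : ∀ {u v} → A u v → A v u) (B-sym : ∀ {u v} → B u v → B v u) where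

    one-path-flex : ∀ {q q′ X} → Path B q q′ X → (q ≢ q′ → A q q′ ⊎ B q q′) → Unique X → TwoFlex A B X
    one-path-flex {q} {q′} {X} Q total uniq with uncons Q
    ... | only _ τ = 0 , 0 , z≤n , flex-single A-sym q τ , flex-single B-sym q τ
    ... | more {T = T} _ Q′ τ with total (unique-++⇒≢ (q ∷ []) (unique-↭ τ uniq) (here refl) (end∈ Q′))
    ...   | inj₂ b = suc (length T) , 0 , ≤-reflexive (trans (+-identityʳ _) (sym (↭-length τ))) ,
      flex-path A-sym T [ q ] (↭-trans τ (++-comm (q ∷ []) T)) , flex-closed B-sym Q (B-sym b)
    ...   | inj₁ a with dropEnd B-sym Q′
    ...     | T′ , _ , τ′ = suc (length T′) , 1 ,
      ≤-reflexive (trans (+-comm (suc (length T′)) 1) (sym (trans (↭-length τ) (cong suc (↭-length τ′))))) ,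
      flex-path A-sym T′ (join [ q ] a [ q′ ])
        (↭-trans τ (↭-trans (prep q τ′) (++-comm (q ∷ q′ ∷ []) T′))) ,
      flex-path B-sym [] Q ↭-refl

    mixed-flex : ∀ {p p′ q q′ S T} → Path A p p′ S → Path B q q′ T → A p′ q → B p q′ → TwoFlex A B (S ++ T)
    mixed-flex {p} {p′} {q} {q′} {S} {T} P Q a b with dropStart P | dropStart Q
    ... | S′ , _ , σ | T′ , _ , τ = suc (length T′) , suc (length S′) ,
      ≤-reflexive (trans (cong₂ _+_ (sym (↭-length τ)) (sym (↭-length σ))) (trans (+-comm (length T) (length S)) (sym (length-++ S)))) ,
      flex-path A-sym T′ (join P a [ q ])
        (↭-trans (++⁺ˡ S τ) (solve 3 (λ s q t → s ⊕ q ⊕ t ⊜ t ⊕ s ⊕ q) ↭-refl S (q ∷ []) T′)) ,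
      flex-path B-sym S′ (join Q (B-sym b) [ p ])
        (↭-trans (++⁺ʳ T σ) (solve 3 (λ s p t → (p ⊕ s) ⊕ t ⊜ s ⊕ t ⊕ p) ↭-refl S′ (p ∷ []) T))

    same-flex : ∀ {p p′ q q′ S T} → Path A p p′ S → Path B q q′ T → A p′ q → A p q′ → TwoFlex A B (S ++ T)
    same-flex {p} {p′} {q} {q′} {S} {T} P Q a a′ with uncons Q
    ... | only refl τ = 0 , suc (length S) ,
      ≤-reflexive (trans (+-comm 1 (length S)) (trans (cong (length S +_) (sym (↭-length τ))) (sym (length-++ S)))) ,
      flex-reorder (++⁺ˡ S (↭-sym τ)) (flex-closed A-sym (join P a [ q ]) (A-sym a′)) ,
      flex-path B-sym S Q ↭-refl
    ... | more {T = T′} _ Q′ τ with dropEnd B-sym Q′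
    ...   | T″ , _ , τ′ = suc (length T″) , suc (length S) ,
      ≤-reflexive (trans (lemma (length T″) (length S)) (trans (cong (length S +_)
        (sym (trans (↭-length τ) (cong suc (↭-length τ′))))) (sym (length-++ S)))) ,
      flex-path A-sym T″ (join [ q′ ] (A-sym a′) (join P a [ q ]))
        (↭-trans (++⁺ˡ S (↭-trans τ (prep q τ′)))
          (solve 4 (λ s q r t → s ⊕ q ⊕ r ⊕ t ⊜ t ⊕ r ⊕ s ⊕ q) ↭-refl S (q ∷ []) (q′ ∷ []) T″)) ,
      flex-path B-sym S Q ↭-refl
      where
      lemma : ∀ t s → suc t + suc s ≡ s + suc (suc t)
      lemma = solve-∀

  reorder-two-flex : ∀ {A B X X′} → X ↭ X′ → TwoFlex A B X → TwoFlex A B X′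
  reorder-two-flex σ (i , j , i+j≤ , f , g) =
    i , j , ≤-trans i+j≤ (≤-reflexive (↭-length σ)) , flex-reorder σ f , flex-reorder σ g

  two-flex : ∀ {A B : V → V → Set} → (∀ {u v} → A u v → A v u) → (∀ {u v} → B u v → B v u) →
    ∀ {X} → Unique X → (∀ {u v} → u ∈ X → v ∈ X → u ≢ v → A u v ⊎ B u v) → TwoFlex A B X
  two-flex {A} {B} A-sym B-sym {X} uniq total with two-paths A-sym B-sym uniq total
  ... | .[] , .[] , none , none , σ = 0 , 0 , z≤n , nothing , nothing
    where
    nothing : ∀ {E} → Flex E X 0
    nothing {Y = []}    _ _   _ = reorder (↭-trans σ (solve 1 (λ x → x ⊜ x ⊕ ∅) ↭-refl X)) none
    nothing {Y = _ ∷ _} _ Y≤X _ with () ← ≤-trans Y≤X (≤-reflexive (sym (↭-length σ)))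
  ... | .[] , T , none , some Q , σ = reorder-two-flex σ
    (one-path-flex A-sym B-sym Q
      (total (∈-resp-↭ σ (start∈ Q)) (∈-resp-↭ σ (end∈ Q))) (unique-↭ (↭-sym σ) uniq))
  ... | S , .[] , some P , none , σ = reorder-two-flex (↭-trans (++-comm [] S) σ)
    (swap-flex (one-path-flex B-sym A-sym P
      (λ ne → Sum.swap (total (∈-resp-↭ σ (∈-++⁺ˡ (start∈ P))) (∈-resp-↭ σ (∈-++⁺ˡ (end∈ P))) ne))
      (unique-++ˡ S (unique-↭ (↭-sym σ) uniq))))
  ... | S , T , some {p} {p′} P , some {q} {q′} Q , σ
    with total (∈-resp-↭ σ (∈-++⁺ˡ (end∈ P))) (∈-resp-↭ σ (∈-++⁺ʳ S (start∈ Q))) (distinct (end∈ P) (start∈ Q))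
       | total (∈-resp-↭ σ (∈-++⁺ˡ (start∈ P))) (∈-resp-↭ σ (∈-++⁺ʳ S (end∈ Q))) (distinct (start∈ P) (end∈ Q))
    where
    distinct : ∀ {u v} → u ∈ S → v ∈ T → u ≢ v
    distinct = unique-++⇒≢ S (unique-↭ (↭-sym σ) uniq)
  ...   | inj₁ a | inj₁ a′ = reorder-two-flex σ (same-flex A-sym B-sym P Q a a′)
  ...   | inj₁ a | inj₂ b  = reorder-two-flex σ (mixed-flex A-sym B-sym P Q a b)
  ...   | inj₂ b | inj₁ a  = reorder-two-flex σ (mixed-flex A-sym B-sym (reverse A-sym P) (reverse B-sym Q) a b)
  ...   | inj₂ b | inj₂ b′ = reorder-two-flex (↭-trans (++-comm T S) σ)
    (swap-flex (same-flex B-sym A-sym Q P (B-sym b′) (B-sym b)))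

  split-list : ∀ a {b} (X : List V) → length X ≡ a + b →
    ∃[ S ] ∃[ T ] S ++ T ≡ X × length S ≡ a × length T ≡ b
  split-list zero    X       eq = [] , X , refl , refl , eq
  split-list (suc a) (x ∷ X) eq with split-list a X (suc-injective eq)
  ... | S , T , refl , refl , eq′ = x ∷ S , T , refl , refl , eq′

  split-number : ∀ {i j n m m′} → i + j ≤ n → n ≤ m + m′ → i ≤ m → j ≤ m′ →
    ∃[ a ] ∃[ b ] n ≡ a + b × i ≤ a × a ≤ m × j ≤ b × b ≤ m′
  split-number {i} {j} {n} {m} {m′} i+j≤n n≤ i≤ j≤ with m + j ≤? n
  ... | yes m+j≤n = m , n ∸ m , sym (m+[n∸m]≡n (≤-trans (m≤m+n m j) m+j≤n)) , i≤ , ≤-refl ,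
    m+n≤o⇒n≤o∸m m+j≤n , m≤n+o⇒m∸n≤o n m n≤
    where
    m+n≤o⇒n≤o∸m : m + j ≤ n → j ≤ n ∸ m
    m+n≤o⇒n≤o∸m le = ≤-trans (≤-reflexive (sym (m+n∸m≡n m j))) (∸-monoˡ-≤ m le)
  ... | no m+j≰n = n ∸ j , j , sym (m∸n+n≡m (≤-trans (m≤n+m j i) i+j≤n)) ,
    ≤-trans (≤-reflexive (sym (m+n∸n≡m i j))) (∸-monoˡ-≤ j i+j≤n) ,
    ≤-trans (∸-monoˡ-≤ j (<⇒≤ (≰⇒> m+j≰n))) (≤-reflexive (m+n∸n≡m m j)) , ≤-refl , j≤

  centre : ∀ {A B : V → V → Set} {X Y Z i j} → Flex A Y i → Flex B Z j →
    i + j ≤ length X → length X ≤ length Y + length Z → i ≤ length Y → j ≤ length Z →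
    Complete A Y X → Complete B Z X → ∃[ S ] ∃[ T ] Cycle A S × Cycle B T × S ++ T ↭ X ++ Y ++ Z
  centre {X = X} {Y} {Z} f g i+j≤ X≤ i≤ j≤ YX ZX with split-number i+j≤ X≤ i≤ j≤
  ... | a , b , eq , i≤a , a≤ , j≤b , b≤ with split-list a X eq
  ...   | S , T , refl , refl , refl =
    Y ++ S , Z ++ T ,
    f i≤a a≤ (λ u v → YX u (∈-++⁺ˡ v)) ,
    g j≤b b≤ (λ u v → ZX u (∈-++⁺ʳ S v)) ,
    solve 4 (λ y z s t → (y ⊕ s) ⊕ z ⊕ t ⊜ (s ⊕ t) ⊕ y ⊕ z) ↭-refl Y Z S T

  drop-many : ∀ {E : V → V → Set} d {X} → MaybePath E X → d ≤ length X →
    ∃[ D ] ∃[ T ] X ↭ D ++ T × length D ≡ d × MaybePath E T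
  drop-many zero {X} P _ = [] , X , ↭-refl , refl , P
  drop-many (suc d) (some {u} P) d≤ with dropStart P
  ... | T , P′ , τ with drop-many d P′ (s≤s⁻¹ (≤-trans d≤ (≤-reflexive (↭-length τ))))
  ...   | D , T′ , σ , eq , P″ = u ∷ D , T′ , ↭-trans τ (prep u σ) , cong suc eq , P″

  short-first-path : ∀ {A B : V → V → Set} → (∀ {u v} → A u v → A v u) → (∀ {u v} → B u v → B v u) →
    ∀ {S T Y Z} → MaybePath B T → length S < length Y → length Y + length Z < length S + length T → 0 < length Z →
    Complete A (S ++ T) Y → Complete B (S ++ T) Z →
    ∃[ C ] ∃[ D ] Cycle A C × Cycle B D × C ++ D ↭ (S ++ T) ++ Y ++ Z
  short-first-path {A} {B} A-sym B-sym {S} {T} {Y} {Z} Q S<Y big 0<Z XY XZ with m≤n⇒∃[o]m+o≡n S<Y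
  ... | o , eq with drop-many (suc o) Q enough
    where
    enough : suc o ≤ length T
    enough = +-cancelˡ-≤ (length S) _ _ (≤-trans (≤-reflexive (trans (+-suc (length S) o) eq))
      (≤-trans (m≤m+n (length Y) (length Z)) (<⇒≤ big)))
  ...   | d ∷ D , T′ , σ , refl , Q′ =
    (d ∷ D ++ S) ++ Y , T′ ++ Z ,
    weave-cycle A-sym (D ++ S) [ d ] (++-comm (d ∷ []) (D ++ S))
      (≤-reflexive (trans (cong suc (trans (length-++ D) (+-comm (length D) (length S)))) eq))
      (≤-reflexive (trans (sym eq) (cong suc (trans (+-comm (length S) (length D)) (sym (length-++ D))))))
      (λ u v → XY (∈-resp-↭ whole (∈-++⁺ˡ u)) v) ,
    last-cycle Q′ ,
    ↭-trans (solve 4 (λ a t y z → (a ⊕ y) ⊕ t ⊕ z ⊜ (a ⊕ t) ⊕ y ⊕ z) ↭-refl (d ∷ D ++ S) T′ Y Z) (++⁺ʳ (Y ++ Z) whole)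
    where
    whole : (d ∷ D ++ S) ++ T′ ↭ S ++ T
    whole = ↭-trans (solve 3 (λ d s t → (d ⊕ s) ⊕ t ⊜ s ⊕ d ⊕ t) ↭-refl (d ∷ D) S T′) (++⁺ˡ S (↭-sym σ))
    T′-long : length Z ≤ length T′
    T′-long = +-cancelˡ-≤ (length Y) _ _ (≤-trans (<⇒≤ big) (≤-reflexive
      (trans (cong (length S +_) (trans (↭-length σ) (length-++ (d ∷ D))))
        (trans (lemma (length S) (length D) (length T′)) (cong (_+ length T′) eq)))))
      where
      lemma : ∀ s d t → s + (suc d + t) ≡ suc s + d + t
      lemma = solve-∀
    last-cycle : MaybePath B T′ → Cycle B (T′ ++ Z)
    last-cycle none with () ← ≤-trans 0<Z T′-long
    last-cycle (some P) = weave-cycle B-sym [] P ↭-refl 0<Z T′-long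
      (λ u v → XZ (∈-resp-↭ whole (∈-++⁺ʳ (d ∷ D ++ S) u)) v)

  TwoCycles : (A B : V → V → Set) → List V → Set
  TwoCycles A B X = ∃[ S ] ∃[ T ] Cycle A S × Cycle B T × S ++ T ↭ X

  reorder-cycles : ∀ {A B X X′} → X ↭ X′ → TwoCycles A B X → TwoCycles A B X′
  reorder-cycles σ (S , T , c , d , τ) = S , T , c , d , ↭-trans τ σ

  big-class : ∀ {A B : V → V → Set} → (∀ {u v} → A u v → A v u) → (∀ {u v} → B u v → B v u) →
    ∀ {X Y Z} → Unique X → (∀ {u v} → u ∈ X → v ∈ X → u ≢ v → A u v ⊎ B u v) →
    length Y + length Z < length X → 0 < length Y → 0 < length Z →
    Complete A X Y → Complete B X Z → TwoCycles A B (X ++ Y ++ Z)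
  big-class {A} {B} A-sym B-sym {X} {Y} {Z} uniq total big 0<Y 0<Z XY XZ with two-paths A-sym B-sym uniq total
  ... | S , T , P , Q , σ with length Y ≤? length S | length Z ≤? length T
  ...   | no Y≰S | _ = reorder-cycles (++⁺ʳ (Y ++ Z) σ)
    (short-first-path A-sym B-sym Q (≰⇒> Y≰S)
      (≤-trans big (≤-reflexive (trans (sym (↭-length σ)) (length-++ S)))) 0<Z
      (λ u v → XY (∈-resp-↭ σ u) v) (λ u v → XZ (∈-resp-↭ σ u) v))
  ...   | yes _ | no Z≰T = swap-two (short-first-path B-sym A-sym P (≰⇒> Z≰T)
      (≤-trans (≤-reflexive (cong suc (+-comm (length Z) (length Y)))) (≤-trans big
        (≤-reflexive (trans (sym (↭-length σ)) (trans (length-++ S) (+-comm (length S) (length T))))))) 0<Y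
      (λ u v → XZ (∈-resp-↭ (↭-trans (++-comm T S) σ) u) v) (λ u v → XY (∈-resp-↭ (↭-trans (++-comm T S) σ) u) v))
    where
    swap-two : TwoCycles B A ((T ++ S) ++ Z ++ Y) → TwoCycles A B (X ++ Y ++ Z)
    swap-two (C , D , c , d , ρ) = D , C , d , c ,
      ↭-trans (++-comm D C) (↭-trans ρ (++⁺ (↭-trans (++-comm T S) σ) (++-comm Z Y)))
  ...   | yes Y≤S | yes Z≤T with P | Q
  ...     | none | _ with () ← ≤-trans 0<Y Y≤S
  ...     | some _ | none with () ← ≤-trans 0<Z Z≤T
  ...     | some P′ | some Q′ = S ++ Y , T ++ Z ,
    weave-cycle A-sym [] P′ ↭-refl 0<Y Y≤S (λ u v → XY (∈-resp-↭ σ (∈-++⁺ˡ u)) v) ,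
    weave-cycle B-sym [] Q′ ↭-refl 0<Z Z≤T (λ u v → XZ (∈-resp-↭ σ (∈-++⁺ʳ S u)) v) ,
    ↭-trans (solve 4 (λ s t y z → (s ⊕ y) ⊕ t ⊕ z ⊜ (s ⊕ t) ⊕ y ⊕ z) ↭-refl S T Y Z) (++⁺ʳ (Y ++ Z) σ)

  three-classes : ∀ {A B C : V → V → Set} →
    (∀ {u v} → A u v → A v u) → (∀ {u v} → B u v → B v u) → (∀ {u v} → C u v → C v u) →
    ∀ {X Y Z} → Unique X → Unique Y → Unique Z → 0 < length X → 0 < length Y → 0 < length Z →
    (∀ {u v} → u ∈ X → v ∈ X → u ≢ v → B u v ⊎ C u v) →
    (∀ {u v} → u ∈ Y → v ∈ Y → u ≢ v → C u v ⊎ A u v) →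
    (∀ {u v} → u ∈ Z → v ∈ Z → u ≢ v → A u v ⊎ B u v) →
    Complete A Y Z → Complete B Z X → Complete C X Y →
    TwoCycles B C (X ++ Y ++ Z) ⊎ TwoCycles C A (X ++ Y ++ Z) ⊎ TwoCycles A B (X ++ Y ++ Z)
  three-classes {A} {B} {C} A-sym B-sym C-sym {X} {Y} {Z} uX uY uZ 0<X 0<Y 0<Z tX tY tZ YZ ZX XY
    with length X ≤? length Z + length Y | length Y ≤? length X + length Z | length Z ≤? length Y + length X
  ... | no X≰ | _ | _ = inj₁ (reorder-cycles (++⁺ˡ X (++-comm Z Y))
      (big-class B-sym C-sym uX tX (≰⇒> X≰) 0<Z 0<Y (λ u v → B-sym (ZX v u)) XY))
  ... | yes _ | no Y≰ | _ = inj₂ (inj₁ (reorder-cycles (solve 3 (λ x y z → y ⊕ x ⊕ z ⊜ x ⊕ y ⊕ z) ↭-refl X Y Z)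
      (big-class C-sym A-sym uY tY (≰⇒> Y≰) 0<X 0<Z (λ u v → C-sym (XY v u)) YZ)))
  ... | yes _ | yes _ | no Z≰ = inj₂ (inj₂ (reorder-cycles (solve 3 (λ x y z → z ⊕ y ⊕ x ⊜ x ⊕ y ⊕ z) ↭-refl X Y Z)
      (big-class A-sym B-sym uZ tZ (≰⇒> Z≰) 0<Y 0<X (λ u v → A-sym (YZ v u)) ZX)))
  ... | yes X≤ | yes Y≤ | yes Z≤
    with two-flex B-sym C-sym uX tX | two-flex C-sym A-sym uY tY | two-flex A-sym B-sym uZ tZ
  ...   | bX , cX , X-sum , fBX , fCX | cY , aY , Y-sum , fCY , fAY | aZ , bZ , Z-sum , fAZ , fBZ
    with bZ + cY ≤? length X | cX + aZ ≤? length Y | aY + bX ≤? length Z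
  ...     | yes X-ok | _ | _ = inj₁ (reorder-cycles (++⁺ˡ X (++-comm Z Y)) (centre fBZ fCY X-ok X≤
      (≤-trans (m≤n+m bZ aZ) Z-sum) (≤-trans (m≤m+n cY aY) Y-sum) ZX (λ u v → C-sym (XY v u))))
  ...     | no _ | yes Y-ok | _ = inj₂ (inj₁ (reorder-cycles (solve 3 (λ x y z → y ⊕ x ⊕ z ⊜ x ⊕ y ⊕ z) ↭-refl X Y Z) (centre fCX fAZ Y-ok Y≤
      (≤-trans (m≤n+m cX bX) X-sum) (≤-trans (m≤m+n aZ bZ) Z-sum) XY (λ u v → A-sym (YZ v u)))))
  ...     | no _ | no _ | yes Z-ok = inj₂ (inj₂ (reorder-cycles (solve 3 (λ x y z → z ⊕ y ⊕ x ⊜ x ⊕ y ⊕ z) ↭-refl X Y Z) (centre fAY fBX Z-ok Z≤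
      (≤-trans (m≤n+m aY cY) Y-sum) (≤-trans (m≤m+n bX cX) X-sum) YZ (λ u v → B-sym (ZX v u)))))
  ...     | no X-fail | no Y-fail | no Z-fail = ⊥-elim (<-irrefl refl (≤-trans
      (+-mono-< (+-mono-< (≰⇒> X-fail) (≰⇒> Y-fail)) (≰⇒> Z-fail))
      (≤-trans (≤-reflexive (lemma bX cX cY aY aZ bZ)) (+-mono-≤ (+-mono-≤ X-sum Y-sum) Z-sum))))
    where
    lemma : ∀ bX cX cY aY aZ bZ → bZ + cY + (cX + aZ) + (aY + bX) ≡ bX + cX + (cY + aY) + (aZ + bZ)
    lemma = solve-∀

-- Two-local colourings

module _ {V : Set} (E : V → V → Set) where

  IsCycle : List V → Set
  IsCycle (u ∷ v ∷ w ∷ vs) = Linked E ((u ∷ v ∷ w ∷ vs) ∷ʳ u)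
  IsCycle _                = ⊤

  isCycle? : (∀ u v → Dec (E u v)) → ∀ xs → Dec (IsCycle xs)
  isCycle? E? []               = yes tt
  isCycle? E? (_ ∷ [])         = yes tt
  isCycle? E? (_ ∷ _ ∷ [])     = yes tt
  isCycle? E? (u ∷ v ∷ w ∷ vs) = Linked.linked? E? ((u ∷ v ∷ w ∷ vs) ∷ʳ u)

cycle⇒list : ∀ {V : Set} {E : V → V → Set} {S} → Cycle E S → ∃[ xs ] xs ↭ S × IsCycle E xs
cycle⇒list none         = [] , ↭-refl , tt
cycle⇒list (single v)   = v ∷ [] , ↭-refl , tt
cycle⇒list (pair u v)   = u ∷ v ∷ [] , ↭-refl , tt
cycle⇒list (reorder σ c) with cycle⇒list c
... | xs , τ , l = xs , ↭-trans τ σ , l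
cycle⇒list (closed {u} P e) with vertices P
... | [] , σ , _ = u ∷ [] , σ , tt
... | v ∷ [] , σ , _ = u ∷ v ∷ [] , σ , tt
... | v ∷ w ∷ vs , σ , link = u ∷ v ∷ w ∷ vs , σ , link e [-]

module _ {n : ℕ} where

  bounded-list? : ∀ k {Q : List (Fin n) → Set} → (∀ xs → Dec (Q xs)) → Dec (∃[ xs ] length xs ≤ k × Q xs)
  bounded-list? zero Q? = map′ (λ q → [] , z≤n , q) (λ { ([] , _ , q) → q }) (Q? [])
  bounded-list? (suc k) {Q} Q? with Q? [] | any? (λ v → bounded-list? k (Q? ∘ (v ∷_)))
  ... | yes q | _                     = yes ([] , z≤n , q)
  ... | no ¬q | yes (v , xs , l , q)  = yes (v ∷ xs , s≤s l , q)
  ... | no ¬q | no ¬r                 = no λ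
    { ([] , _ , q) → ¬q q ; (v ∷ xs , s≤s l , q) → ¬r (v , xs , l , q) }

  unique-++ʳ : ∀ xs {ys : List (Fin n)} → Unique (xs ++ ys) → Unique ys
  unique-++ʳ []       uniq       = uniq
  unique-++ʳ (_ ∷ xs) (_ ∷ uniq) = unique-++ʳ xs uniq

  covering⇒partition : ∀ (xs : List (Fin n)) {ys} → Unique (xs ++ ys) → (∀ v → v ∈ xs ++ ys) → IsPartition xs ys
  covering⇒partition xs uniq covers =
    (λ (p , q) → unique-++⇒≢ xs uniq p q refl) , λ v → ∈-++⁻ xs (covers v)

module _ {n : ℕ} (χ : EdgeColouring n) where

  Has : Colour → Fin n → Fin n → Set
  Has c u v = colour χ u v ≡ c

  Has-sym : ∀ {c u v} → Has c u v → Has c v u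
  Has-sym {c} {u} {v} e = trans (colour-sym χ v u) e

  Partitioned : Set
  Partitioned = ∃[ a ] ∃[ b ] ∃[ xs ] ∃[ ys ]
    a ≢ b × MonoCycle χ a xs × MonoCycle χ b ys × IsPartition xs ys

  list⇒mono : ∀ {c xs} → IsCycle (Has c) xs → Unique xs → MonoCycle χ c xs
  list⇒mono {xs = []}             _ _                 = empty
  list⇒mono {xs = v ∷ []}         _ _                 = vertex v
  list⇒mono {xs = _ ∷ _ ∷ []}     _ ((u≢v ∷ _) ∷ _)   = edge u≢v
  list⇒mono {xs = _ ∷ _ ∷ _ ∷ _}  l uniq              = cycle uniq l

  two-cycles⇒partitioned : ∀ {a b} → a ≢ b → TwoCycles (Has a) (Has b) (allFin n) → Partitioned
  two-cycles⇒partitioned {a} {b} a≢b (S , T , c , d , σ) with cycle⇒list c | cycle⇒list d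
  ... | xs , τ , l | ys , τ′ , l′ = a , b , xs , ys , a≢b ,
    list⇒mono l (unique-++ˡ xs uniq) , list⇒mono l′ (unique-++ʳ xs uniq) ,
    covering⇒partition xs uniq λ v → ∈-resp-↭ (↭-sym whole) (∈-allFin v)
    where
    whole : xs ++ ys ↭ allFin n
    whole = ↭-trans (++⁺ τ τ′) σ
    uniq = unique-↭ (↭-sym whole) (allFin⁺ n)

  Star : Colour → Fin n → Set
  Star a v = ∃[ c ] (∀ u → u ≢ v → Has a v u ⊎ Has c v u)

  module StarCase (a : Colour) (star : ∀ v → Star a v) where

    Other : Fin n → Fin n → Set
    Other u v = ¬ Has a u v

    Solution : List (Fin n) → List (Fin n) → Set
    Solution xs ys = IsCycle (Has a) xs × IsCycle Other ys × Unique (xs ++ ys) × All (_∈ xs ++ ys) (allFin n)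

    solution? : ∀ xs ys → Dec (Solution xs ys)
    solution? xs ys = isCycle? (Has a) (λ u v → colour χ u v ≟ a) xs
      ×-dec isCycle? Other (λ u v → ¬? (colour χ u v ≟ a)) ys
      ×-dec DecUnique.unique? _≟ᶠ_ (xs ++ ys)
      ×-dec All.all? (λ v → DecMembership._∈?_ _≟ᶠ_ v (xs ++ ys)) (allFin n)

    -- The two-colour theorem only comes as a double negation; there are finitely many candidates to try.
    solution : ∃[ xs ] ∃[ ys ] Solution xs ys
    solution with bounded-list? n (λ xs → bounded-list? n (solution? xs))
    ... | yes (xs , _ , ys , _ , s) = xs , ys , s
    ... | no ¬found = ⊥-elim (two-colour-contradiction {R = Has a} {B = Other} Has-sym (λ ne e → ne (Has-sym e))
      total (λ e ne → ne e) (allFin⁺ n) no-cycles)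
      where
      total : ∀ u v → Has a u v ⊎ Other u v
      total u v with colour χ u v ≟ a
      ... | yes e = inj₁ e
      ... | no ne = inj₂ ne
      no-cycles : ∀ {S T} → Cycle (Has a) S → Cycle Other T → S ++ T ↭ allFin n → ⊥
      no-cycles c d σ with cycle⇒list c | cycle⇒list d
      ... | xs , τ , l | ys , τ′ , l′ = ¬found (xs , ≤-trans (m≤m+n _ _) bound , ys , ≤-trans (m≤n+m _ (length xs)) bound ,
        l , l′ , unique-↭ (↭-sym whole) (allFin⁺ n) , All.tabulate (λ v∈ → ∈-resp-↭ (↭-sym whole) v∈))
        where
        whole : xs ++ ys ↭ allFin n
        whole = ↭-trans (++⁺ τ τ′) σ
        bound : length xs + length ys ≤ n
        bound = ≤-reflexive (trans (sym (length-++ xs)) (trans (↭-length whole) (length-tabulate _)))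

    same-colour : ∀ {u v w} → u ≢ v → v ≢ w → Other u v → Other v w → colour χ v w ≡ colour χ u v
    same-colour {u} {v} {w} u≢v v≢w uv vw with star v
    ... | c , sees with sees u u≢v | sees w (v≢w ∘ sym)
    ...   | inj₁ e | _      = ⊥-elim (uv (Has-sym e))
    ...   | inj₂ _ | inj₁ e = ⊥-elim (vw e)
    ...   | inj₂ e | inj₂ f = trans f (sym (Has-sym e))

    constant : ∀ {b x y zs} → Linked Other (x ∷ y ∷ zs) → Linked _≢_ (x ∷ y ∷ zs) → Has b x y →
      Linked (Has b) (x ∷ y ∷ zs)
    constant {zs = []}    _              _               e = e ∷ [-]
    constant {zs = _ ∷ _} (o ∷ o′ ∷ os) (ne ∷ ne′ ∷ nes) e =
      e ∷ constant (o′ ∷ os) (ne′ ∷ nes) (trans (same-colour ne ne′ o o′) e)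

    distinct : ∀ {u x : Fin n} {xs} → Unique (x ∷ xs) → All (u ≢_) (x ∷ xs) → Linked _≢_ ((x ∷ xs) ∷ʳ u)
    distinct {xs = []}    _                   (u≢x ∷ _) = (u≢x ∘ sym) ∷ [-]
    distinct {xs = _ ∷ _} ((x≢y ∷ _) ∷ uniq) (_ ∷ u∉)  = x≢y ∷ distinct uniq u∉

    other-cycle : ∀ {ys} → IsCycle Other ys → Unique ys → ∃[ b ] a ≢ b × MonoCycle χ b ys
    other-cycle {[]}         _ uniq = suc a , 1+n≢n ∘ sym , list⇒mono tt uniq
    other-cycle {_ ∷ []}     _ uniq = suc a , 1+n≢n ∘ sym , list⇒mono tt uniq
    other-cycle {_ ∷ _ ∷ []} _ uniq = suc a , 1+n≢n ∘ sym , list⇒mono tt uniq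
    other-cycle {u ∷ v ∷ _ ∷ _} l@(o ∷ _) uniq@(u∉@(u≢v ∷ _) ∷ uniq′) =
      colour χ u v , o ∘ sym , cycle uniq (constant l (u≢v ∷ distinct uniq′ u∉) refl)

    partitioned : Partitioned
    partitioned with solution
    ... | xs , ys , l , l′ , uniq , covers with other-cycle l′ (unique-++ʳ xs uniq)
    ...   | b , a≢b , c = a , b , xs , ys , a≢b , list⇒mono l (unique-++ˡ xs uniq) , c ,
      covering⇒partition xs uniq (λ v → All.lookup covers (∈-allFin v))

  Sees : Colour → Colour → Fin n → Set
  Sees p q v = ∀ u → u ≢ v → Has p v u ⊎ Has q v u

  module TriangleCase {a b c : Colour} (a≢b : a ≢ b) (b≢c : b ≢ c) (c≢a : c ≢ a) {u v w : Fin n}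
    (u-bc : Sees b c u) (v-ca : Sees c a v) (w-ab : Sees a b w)
    (uv : Has c u v) (vw : Has a v w) (wu : Has b w u)
    (classify : ∀ z → Sees b c z ⊎ Sees c a z ⊎ Sees a b z) where

    classes : ∀ L → ∃[ X ] ∃[ Y ] ∃[ Z ] X ++ Y ++ Z ↭ L ×
      All (Sees b c) X × All (Sees c a) Y × All (Sees a b) Z
    classes [] = [] , [] , [] , ↭-refl , [] , [] , []
    classes (z ∷ L) with classes L | classify z
    ... | X , Y , Z , σ , xs , ys , zs | inj₁ s = z ∷ X , Y , Z , prep z σ , s ∷ xs , ys , zs
    ... | X , Y , Z , σ , xs , ys , zs | inj₂ (inj₁ s) = X , z ∷ Y , Z ,
      ↭-trans (solve 4 (λ x y z v → x ⊕ (v ⊕ y) ⊕ z ⊜ v ⊕ x ⊕ y ⊕ z) ↭-refl X Y Z (z ∷ [])) (prep z σ) , xs , s ∷ ys , zs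
    ... | X , Y , Z , σ , xs , ys , zs | inj₂ (inj₂ s) = X , Y , z ∷ Z ,
      ↭-trans (solve 4 (λ x y z v → x ⊕ y ⊕ v ⊕ z ⊜ v ⊕ x ⊕ y ⊕ z) ↭-refl X Y Z (z ∷ [])) (prep z σ) , xs , ys , s ∷ zs

    unseen : ∀ {p q r x y} → x ≢ y → p ≢ r → q ≢ r → Has r x y → Sees p q x → ⊥
    unseen {x = x} {y} x≢y p≢r q≢r e sees with sees y (x≢y ∘ sym)
    ... | inj₁ f = p≢r (trans (sym f) e)
    ... | inj₂ f = q≢r (trans (sym f) e)

    common : ∀ {p q r x y} → x ≢ y → p ≢ q → q ≢ r → r ≢ p → Sees p q x → Sees q r y → Has q x y
    common {x = x} {y} x≢y p≢q q≢r r≢p sx sy with sx y (x≢y ∘ sym) | sy x x≢y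
    ... | inj₂ e | _      = e
    ... | inj₁ _ | inj₁ f = Has-sym f
    ... | inj₁ e | inj₂ f = ⊥-elim (r≢p (trans (sym f) (Has-sym e)))

    nonempty : ∀ {x : Fin n} {L} → x ∈ L → 0 < length L
    nonempty (here _)  = s≤s z≤n
    nonempty (there _) = s≤s z≤n

    partitioned : u ≢ v → v ≢ w → w ≢ u → Partitioned
    partitioned u≢v v≢w w≢u with classes (allFin n)
    ... | X , Y , Z , σ , xs , ys , zs = finish (three-classes Has-sym Has-sym Has-sym
        (unique-++ˡ X uniq) (unique-++ˡ Y (unique-++ʳ X uniq)) (unique-++ʳ Y (unique-++ʳ X uniq))
        (nonempty u∈X) (nonempty v∈Y) (nonempty w∈Z)
        (λ p _ ne → All.lookup xs p _ (ne ∘ sym)) (λ p _ ne → All.lookup ys p _ (ne ∘ sym)) (λ p _ ne → All.lookup zs p _ (ne ∘ sym))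
        (λ p q → common (unique-++⇒≢ Y (unique-++ʳ X uniq) p q) c≢a a≢b b≢c (All.lookup ys p) (All.lookup zs q))
        (λ p q → common (λ e → unique-++⇒≢ X uniq q (∈-++⁺ʳ Y p) (sym e)) a≢b b≢c c≢a (All.lookup zs p) (All.lookup xs q))
        (λ p q → common (unique-++⇒≢ X uniq p (∈-++⁺ˡ q)) b≢c c≢a a≢b (All.lookup xs p) (All.lookup ys q)))
      where
      uniq : Unique (X ++ Y ++ Z)
      uniq = unique-↭ (↭-sym σ) (allFin⁺ n)
      member : ∀ x → x ∈ X ⊎ x ∈ Y ⊎ x ∈ Z
      member x with ∈-++⁻ X (∈-resp-↭ (↭-sym σ) (∈-allFin x))
      ... | inj₁ p = inj₁ p
      ... | inj₂ p = inj₂ (∈-++⁻ Y p)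
      u∈X : u ∈ X
      u∈X with member u
      ... | inj₁ p        = p
      ... | inj₂ (inj₁ p) = ⊥-elim (unseen (w≢u ∘ sym) (b≢c ∘ sym) a≢b (Has-sym wu) (All.lookup ys p))
      ... | inj₂ (inj₂ p) = ⊥-elim (unseen u≢v (c≢a ∘ sym) b≢c uv (All.lookup zs p))
      v∈Y : v ∈ Y
      v∈Y with member v
      ... | inj₂ (inj₁ p) = p
      ... | inj₁ p        = ⊥-elim (unseen v≢w (a≢b ∘ sym) c≢a vw (All.lookup xs p))
      ... | inj₂ (inj₂ p) = ⊥-elim (unseen (u≢v ∘ sym) (c≢a ∘ sym) b≢c (Has-sym uv) (All.lookup zs p))
      w∈Z : w ∈ Z
      w∈Z with member w
      ... | inj₂ (inj₂ p) = p
      ... | inj₁ p        = ⊥-elim (unseen (v≢w ∘ sym) (a≢b ∘ sym) c≢a (Has-sym vw) (All.lookup xs p))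
      ... | inj₂ (inj₁ p) = ⊥-elim (unseen w≢u (b≢c ∘ sym) a≢b wu (All.lookup ys p))
      finish : TwoCycles (Has b) (Has c) (X ++ Y ++ Z) ⊎ TwoCycles (Has c) (Has a) (X ++ Y ++ Z) ⊎
        TwoCycles (Has a) (Has b) (X ++ Y ++ Z) → Partitioned
      finish (inj₁ t)        = two-cycles⇒partitioned b≢c (reorder-cycles σ t)
      finish (inj₂ (inj₁ t)) = two-cycles⇒partitioned c≢a (reorder-cycles σ t)
      finish (inj₂ (inj₂ t)) = two-cycles⇒partitioned a≢b (reorder-cycles σ t)

  sees-swap : ∀ {p q v} → Sees p q v → Sees q p v
  sees-swap s u u≢v = Sum.swap (s u u≢v)

  palette : IsLocal 2 χ → ∀ v → ∃[ p ] ∃[ q ] Sees p q v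
  palette local v with local v
  ... | [] , _ , sees            = 0 , 0 , λ u u≢v → ⊥-elim (¬Any[] (sees u u≢v))
  ... | p ∷ [] , _ , sees        = p , p , λ u u≢v → first (sees u u≢v)
    where
    first : ∀ {c} → c ∈ p ∷ [] → c ≡ p ⊎ c ≡ p
    first (here e) = inj₁ e
  ... | p ∷ q ∷ [] , _ , sees    = p , q , λ u u≢v → either (sees u u≢v)
    where
    either : ∀ {c} → c ∈ p ∷ q ∷ [] → c ≡ p ⊎ c ≡ q
    either (here e)         = inj₁ e
    either (there (here e)) = inj₂ e
  ... | _ ∷ _ ∷ _ ∷ _ , s≤s (s≤s ()) , _

  sees-both : ∀ {p q z x y u v} → Sees p q z → x ≢ y → u ≢ z → v ≢ z → Has x z u → Has y z v → Sees x y z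
  sees-both {z = z} {u = u} {v = v} s x≢y u≢z v≢z refl refl t t≢z with s u u≢z | s v v≢z | s t t≢z
  ... | inj₁ refl | inj₁ e    | _      = ⊥-elim (x≢y (sym e))
  ... | inj₂ refl | inj₂ e    | _      = ⊥-elim (x≢y (sym e))
  ... | inj₁ e    | inj₂ f    | inj₁ g = inj₁ (trans g (sym e))
  ... | inj₁ e    | inj₂ f    | inj₂ g = inj₂ (trans g (sym f))
  ... | inj₂ e    | inj₁ f    | inj₁ g = inj₂ (trans g (sym f))
  ... | inj₂ e    | inj₁ f    | inj₂ g = inj₁ (trans g (sym e))

  triangle-classify : ∀ {a b c} → a ≢ b → b ≢ c → c ≢ a → ∀ {u v w} →
    Sees b c u → Sees c a v → Sees a b w → (∀ z → ∃[ p ] ∃[ q ] Sees p q z) →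
    ∀ z → Sees b c z ⊎ Sees c a z ⊎ Sees a b z
  triangle-classify a≢b b≢c c≢a {u} {v} {w} u-bc v-ca w-ab pal z with z ≟ᶠ u | z ≟ᶠ v | z ≟ᶠ w
  ... | yes refl | _ | _ = inj₁ u-bc
  ... | no _ | yes refl | _ = inj₂ (inj₁ v-ca)
  ... | no _ | no _ | yes refl = inj₂ (inj₂ w-ab)
  ... | no z≢u | no z≢v | no z≢w with pal z | u-bc z z≢u | v-ca z z≢v | w-ab z z≢w
  ...   | _ , _ , s | inj₁ ub | _       | inj₁ wa = inj₂ (inj₂ (sees-both s a≢b (z≢w ∘ sym) (z≢u ∘ sym) (Has-sym wa) (Has-sym ub)))
  ...   | _ , _ , s | inj₂ uc | _       | inj₁ wa = inj₂ (inj₁ (sees-both s c≢a (z≢u ∘ sym) (z≢w ∘ sym) (Has-sym uc) (Has-sym wa)))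
  ...   | _ , _ , s | _       | inj₂ va | inj₂ wb = inj₂ (inj₂ (sees-both s a≢b (z≢v ∘ sym) (z≢w ∘ sym) (Has-sym va) (Has-sym wb)))
  ...   | _ , _ , s | _       | inj₁ vc | inj₂ wb = inj₁ (sees-both s b≢c (z≢w ∘ sym) (z≢v ∘ sym) (Has-sym wb) (Has-sym vc))

all-or-some : ∀ n {P Q : Fin n → Set} → (∀ v → P v ⊎ Q v) → (∀ v → P v) ⊎ (∃[ v ] Q v)
all-or-some zero    dec = inj₁ λ ()
all-or-some (suc n) dec with dec Fin.zero | all-or-some n (dec ∘ Fin.suc)
... | inj₂ q | _            = inj₂ (Fin.zero , q)
... | inj₁ _ | inj₂ (v , q) = inj₂ (Fin.suc v , q)
... | inj₁ p | inj₁ ps      = inj₁ λ { Fin.zero → p ; (Fin.suc v) → ps v }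

module TwoLocal {n} (χ : EdgeColouring (suc n)) (local : IsLocal 2 χ) where

  pal = palette χ local
  left right : Fin (suc n) → Colour
  left v  = proj₁ (pal v)
  right v = proj₁ (proj₂ (pal v))

  sees : ∀ v → Sees χ (left v) (right v) v
  sees v = proj₂ (proj₂ (pal v))

  NotStar : Colour → Fin (suc n) → Set
  NotStar c v = c ≢ left v × c ≢ right v × left v ≢ right v

  star? : ∀ c v → Star χ c v ⊎ NotStar c v
  star? c v with c ≟ left v | c ≟ right v | left v ≟ right v
  ... | yes refl | _        | _     = inj₁ (right v , sees v)
  ... | no _     | yes refl | _     = inj₁ (left v , sees-swap χ (sees v))
  ... | no _     | no _     | yes e = inj₁ (right v , λ u u≢v → inj₂ (either (sees v u u≢v)))
    where
    either : ∀ {d} → d ≡ left v ⊎ d ≡ right v → d ≡ right v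
    either (inj₁ f) = trans f e
    either (inj₂ f) = f
  ... | no x     | no y     | no z  = inj₂ (x , y , z)

  a = left Fin.zero
  b = right Fin.zero

  third-colour : ∀ {p q} → Sees χ p q Fin.zero → ∀ {v} → NotStar p v → Fin.zero ≢ v →
    ∃[ c ] Sees χ q c v × p ≢ q × c ≢ p × c ≢ q × Has χ q Fin.zero v × (q ≡ left v ⊎ q ≡ right v)
  third-colour s {v} (p≢l , p≢r , l≢r) 0≢v with s v (0≢v ∘ sym) | sees v Fin.zero 0≢v
  ... | inj₁ e | inj₁ f = ⊥-elim (p≢l (trans (sym e) (Has-sym χ f)))
  ... | inj₁ e | inj₂ f = ⊥-elim (p≢r (trans (sym e) (Has-sym χ f)))
  ... | inj₂ e | inj₁ f with refl ← trans (sym e) (Has-sym χ f) =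
    right v , sees v , p≢l , p≢r ∘ sym , l≢r ∘ sym , e , inj₁ refl
  ... | inj₂ e | inj₂ f with refl ← trans (sym e) (Has-sym χ f) =
    left v , sees-swap χ (sees v) , p≢r , p≢l ∘ sym , l≢r , e , inj₂ refl

  separated : ∀ {q u w} → q ≡ left u ⊎ q ≡ right u → NotStar q w → u ≢ w
  separated (inj₁ e) (q≢l , _)     refl = q≢l e
  separated (inj₂ e) (_ , q≢r , _) refl = q≢r e

  partitioned : Partitioned χ
  partitioned with all-or-some (suc n) (star? a) | all-or-some (suc n) (star? b)
  ... | inj₁ stars | _          = StarCase.partitioned χ a stars
  ... | inj₂ _     | inj₁ stars = StarCase.partitioned χ b stars
  ... | inj₂ (u , u-not) | inj₂ (w , w-not)
    with third-colour (sees Fin.zero) u-not (separated (inj₁ refl) u-not)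
       | third-colour (sees-swap χ (sees Fin.zero)) w-not (separated (inj₂ refl) w-not)
  ...   | c , u-bc , a≢b , c≢a , c≢b , 0u , b∈u | d , w-ad , _ , d≢b , d≢a , 0w , _ = triangle uw
    where
    u≢w : u ≢ w
    u≢w = separated b∈u w-not
    uw : Has χ c u w × d ≡ c
    uw with u-bc w (u≢w ∘ sym) | w-ad u u≢w
    ... | inj₁ e | inj₁ f = ⊥-elim (a≢b (trans (sym f) (Has-sym χ e)))
    ... | inj₁ e | inj₂ f = ⊥-elim (d≢b (trans (sym f) (Has-sym χ e)))
    ... | inj₂ e | inj₁ f = ⊥-elim (c≢a (trans (sym (Has-sym χ e)) f))
    ... | inj₂ e | inj₂ f = e , trans (sym f) (Has-sym χ e)
    triangle : Has χ c u w × d ≡ c → Partitioned χ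
    triangle (uw , refl) = TriangleCase.partitioned χ a≢b (c≢b ∘ sym) c≢a
      u-bc (sees-swap χ w-ad) (sees Fin.zero) uw (Has-sym χ 0w) 0u
      (triangle-classify χ a≢b (c≢b ∘ sym) c≢a u-bc (sees-swap χ w-ad) (sees Fin.zero) pal)
      u≢w (separated (inj₂ refl) w-not ∘ sym) (separated (inj₁ refl) u-not)

theorem1p2 : (n : ℕ) → n ≥ 1 → (χ : EdgeColouring n) → IsLocal 2 χ →
    ∃[ a ] ∃[ b ] ∃[ xs ] ∃[ ys ]
    a ≢ b × MonoCycle χ a xs × MonoCycle χ b ys × IsPartition xs ys
theorem1p2 (suc n) _ χ local = TwoLocal.partitioned χ local
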